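{- Let $\mathcal B,\tilde{\mathcal B}$ be any two circles of $\mathbb M(q)$ and let $\tau$ be any Möbius transformation of $\mathbb M(q)$. Then $$\operatorname{cap}(\mathcal B,\tilde{\mathcal B})=\operatorname{cap}(\tau(\mathcal B),\tau(\tilde{\mathcal B})).$$
   Context: Let $p$ be an odd prime, $m\ge1$, and $q=p^m$. $GF(q^2)$ denotes the quadratic extension of $GF(q)$, and for $z\in GF(q^2)$ we write $\bar z:=z^{q}$. The Miquelian Möbius plane $\mathbb M(q)$ has point set $GF(q^2)\cup\{\infty\}$ and circles of two types: for $s\in GF(q^2)$ and $c\in GF(q)\setminus\{0\}$, $\mathcal B^1_{(s,c)}=\{z\in GF(q^2):(z-s)(\bar z-\bar s)=c\}$; for $s\in GF(q^2)\setminus\{0\}$ and $c\in GF(q)$, $\mathcal B^2_{(s,c)}=\{z\in GF(q^2):\bar s z+s\bar z=c\}\cup\{\infty\}$ (note $\mathcal B^2_{(\lambda s,\lambda c)}=\mathcal B^2_{(s,c)}$ for $\lambda\in GF(q)\setminus\{0\}$). A Möbius transformation is a map $\Phi(z)=\frac{az+b}{cz+d}$ with $a,b,c,d\in GF(q^2)$, $ad-bc\neq0$, extended to $GF(q^2)\cup\{\infty\}$ by $\Phi(z)=\infty$ if $cz+d=0$, $\Phi(\infty)=a/c$ if $c\ne0$, $\Phi(\infty)=\infty$ if $c=0$; it maps circles to circles. The capacitance of a pair of circles is the element of $GF(q)$ defined by $\operatorname{cap}(\mathcal B^1_{(s_1,c_1)},\mathcal B^1_{(s_2,c_2)})=\frac{1}{c_1c_2}\bigl(c_1+c_2-(s_1-s_2)(\bar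 s_1-\bar s_2)\bigr)^2$, $\operatorname{cap}(\mathcal B^1_{(s_1,c_1)},\mathcal B^2_{(s_2,c_2)})=\operatorname{cap}(\mathcal B^2_{(s_2,c_2)},\mathcal B^1_{(s_1,c_1)})=\frac{1}{c_1s_2\bar s_2}(s_1\bar s_2+\bar s_1s_2-c_2)^2$, $\operatorname{cap}(\mathcal B^2_{(s_1,c_1)},\mathcal B^2_{(s_2,c_2)})=\frac{1}{s_1\bar s_1s_2\bar s_2}(s_1\bar s_2+\bar s_1s_2)^2$. -}

module Defs where

open import Algebra.Bundles using (CommutativeRing)
open import Algebra.Morphism.Structures using (module RingMorphisms)
import Algebra.Properties.Semiring.Exp as Exp
open import Data.Bool.Base using (if_then_else_)
open import Data.Empty.Polymorphic using (⊥)
open import Data.Fin.Base using (Fin)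
import Data.Fin.Properties as Fin
open import Data.Nat.Base as ℕ using (ℕ)
open import Data.Product.Base using (∃; _×_)
open import Data.Unit.Polymorphic using (⊤)
open import Function.Bundles using (Inverse)
open import Function.Properties.Inverse using (Inverse⇒Injection)
import Function.Construct.Symmetry as Symmetry
open import Level using (Level; suc; _⊔_)
open import Relation.Binary.Definitions using (Decidable)
open import Relation.Binary.PropositionalEquality.Properties using (setoid)
open import Relation.Nullary.Decidable using (via-injection; does)
open import Relation.Unary using (Pred; _∈_; _≐_)

-- The value of 0# ⁻¹ is unconstrained.
record Field (c ℓ : Level) : Set (suc (c ⊔ ℓ)) where
  field
    commutativeRing : CommutativeRing c ℓ

  open CommutativeRing commutativeRing public

  infix 8 _⁻¹

  field
    0≉1      : 0# ≉ 1#
    _⁻¹      : Carrier → Carrier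
    inverseʳ : ∀ x → x ≉ 0# → x * x ⁻¹ ≈ 1#

HasOrder : ∀ {c ℓ} → Field c ℓ → ℕ → Set (c ⊔ ℓ)
HasOrder F n = Inverse (setoid (Fin n)) (Field.setoid F)

-- GF(q) together with its quadratic extension GF(q²); that the degree is two
-- is expressed by the orders.
record QuadraticExtension (q : ℕ) (c₁ ℓ₁ c₂ ℓ₂ : Level)
       : Set (suc (c₁ ⊔ ℓ₁ ⊔ c₂ ⊔ ℓ₂)) where
  field
    GF[q]  : Field c₁ ℓ₁
    GF[q²] : Field c₂ ℓ₂

  private
    module F = Field GF[q]
    module K = Field GF[q²]

  open RingMorphisms F.rawRing K.rawRing using (IsRingHomomorphism)

  field
    ι                  : F.Carrier → K.Carrier
    isRingHomomorphism : IsRingHomomorphism ι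
    GF[q]-order        : HasOrder GF[q] q
    GF[q²]-order       : HasOrder GF[q²] (q ℕ.^ 2)

module MöbiusPlane
  {q : ℕ} {a₁ ℓ₁ a₂ ℓ₂ : Level} (E : QuadraticExtension q a₁ ℓ₁ a₂ ℓ₂) where

  open QuadraticExtension E public
  module F = Field GF[q]
  module K = Field GF[q²]
  open K using (Carrier; _≈_; _≉_; 0#; _+_; _*_; _-_; _⁻¹)
  open Exp K.semiring using (_^_)

  _≟_ : Decidable _≈_
  _≟_ = via-injection
    (Inverse⇒Injection (Symmetry.inverse GF[q²]-order)) Fin._≟_

  bar : Carrier → Carrier
  bar z = z ^ q

  data Point : Set a₂ where
    fin : Carrier → Point
    ∞   : Point

  infix 4 _≈ₚ_

  data _≈ₚ_ : Point → Point → Set (a₂ ⊔ ℓ₂) where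
    fin : ∀ {z w} → z ≈ w → fin z ≈ₚ fin w
    ∞   : ∞ ≈ₚ ∞

  -- Parameters of a circle.  The circle itself is the point set ⟦_⟧; distinct
  -- parameters may describe the same circle.
  data Circle : Set (a₁ ⊔ ℓ₁ ⊔ a₂ ⊔ ℓ₂) where
    B¹ : (s : Carrier) (c : F.Carrier) → c F.≉ F.0# → Circle
    B² : (s : Carrier) (c : F.Carrier) → s ≉ 0# → Circle

  ⟦_⟧ : Circle → Pred Point ℓ₂
  ⟦ B¹ s c _ ⟧ (fin z) = (z - s) * (bar z - bar s) ≈ ι c
  ⟦ B¹ s c _ ⟧ ∞       = ⊥
  ⟦ B² s c _ ⟧ (fin z) = bar s * z + s * bar z ≈ ι c
  ⟦ B² s c _ ⟧ ∞       = ⊤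

  cap : Circle → Circle → Carrier
  cap (B¹ s₁ c₁ _) (B¹ s₂ c₂ _) =
    (ι c₁ * ι c₂) ⁻¹ * (ι c₁ + ι c₂ - (s₁ - s₂) * (bar s₁ - bar s₂)) ^ 2
  cap (B¹ s₁ c₁ _) (B² s₂ c₂ _) =
    (ι c₁ * (s₂ * bar s₂)) ⁻¹ * (s₁ * bar s₂ + bar s₁ * s₂ - ι c₂) ^ 2
  cap B@(B² _ _ _) B′@(B¹ _ _ _) = cap B′ B
  cap (B² s₁ c₁ _) (B² s₂ c₂ _) =
    ((s₁ * bar s₁) * (s₂ * bar s₂)) ⁻¹ * (s₁ * bar s₂ + bar s₁ * s₂) ^ 2

  -- x / y, with value ∞ when y is zero.
  _÷_ : Carrier → Carrier → Point
  x ÷ y = if does (y ≟ 0#) then ∞ else fin (x * y ⁻¹)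

  record MöbiusTransformation : Set (a₂ ⊔ ℓ₂) where
    field
      a b c d : Carrier
      ad-bc≉0 : a * d - b * c ≉ 0#

    apply : Point → Point
    apply (fin z) = (a * z + b) ÷ (c * z + d)
    apply ∞       = a ÷ c

  open MöbiusTransformation public using (apply)

  image : MöbiusTransformation → Pred Point ℓ₂ → Pred Point (a₂ ⊔ ℓ₂)
  image τ S w = ∃ λ z → z ∈ S × apply τ z ≈ₚ w

  _Describes_ : Circle → Pred Point (a₂ ⊔ ℓ₂) → Set (a₂ ⊔ ℓ₂)
  C Describes S = ⟦ C ⟧ ≐ S

{-# OPTIONS --safe #-}

-- A circle is the zero set of a Hermitian form αxx̄ + β̄xȳ + βx̄y + γyȳ in
-- homogeneous coordinates, with discriminant D = ββ̄ - αγ ≠ 0.  In terms of the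
-- forms, cap = P² / (D₁D₂), where P is the polar form of D.  A Möbius
-- transformation τ acts on forms by substitution and multiplies both D and P by
-- det τ · bar (det τ), so P² / (D₁D₂) does not change; nor does it change when
-- the forms are scaled by elements of GF(q).  It remains to see that a circle
-- determines its form up to such a scalar.  For this a circle of the first type
-- must have a point, which is the surjectivity of the norm GF(q²)* → GF(q)*, and
-- the coefficients of a form must lie in GF(q), which is identified with the
-- fixed field of z ↦ z^q; both follow from the bound on the number of roots of a
-- polynomial.
module Submission where

open import Defs
open import Algebra.Bundles using (CommutativeMonoid; CommutativeRing)
open import Algebra.Morphism.Structures using (module RingMorphisms)
import Algebra.Properties.AbelianGroup
import Algebra.Properties.CommutativeMonoid.Sum
import Algebra.Properties.CommutativeSemiring.Binomial
import Algebra.Properties.CommutativeSemiring.Exp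
import Algebra.Properties.Group
import Algebra.Properties.Ring
import Algebra.Properties.Semiring.Mult
import Algebra.Properties.Semiring.Mult.TCOptimised
import Algebra.Solver.Ring
open import Algebra.Solver.Ring.AlmostCommutativeRing using (fromCommutativeRing; _-Raw-AlmostCommutative⟶_)
open import Data.Bool.Base using (if_then_else_)
open import Data.Empty using (⊥; ⊥-elim)
open import Data.Fin.Base as Fin using (Fin; zero; suc; fromℕ; inject₁; inject≤; punchIn)
open import Data.Fin.Permutation using (Permutation′; permutation)
import Data.Fin.Properties as Fin
open import Data.Integer.Base as ℤ using (ℤ; +_; -[1+_]; _⊖_)
import Data.Integer.Properties as ℤ
open import Data.Maybe.Base using (Maybe; just; nothing)
open import Data.Nat.Base as ℕ using (ℕ; zero; suc; s≤s; z≤n; _!)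
open import Data.Nat.Combinatorics using (nCk≡n!/k![n-k]!; k![n∸k]!∣n!; nCn≡1) renaming (_C_ to _choose_)
open import Data.Nat.Divisibility using (_∣_; divides; ∣⇒≤; m∣m*n)
open import Data.Nat.DivMod using (m/n*n≡m; m≡m%n+[m/n]*n; m%n<n)
open import Data.Nat.Primality using (Prime; euclidsLemma; prime⇒irreducible; prime⇒nonTrivial; prime⇒nonZero)
import Data.Nat.Properties as ℕ
open import Data.Nat.Solver using (module +-*-Solver)
open import Data.Product.Base using (∃; _×_; _,_; proj₁; proj₂; map₂)
open import Data.Sum.Base using (inj₁; inj₂)
open import Data.Vec.Base using (Vec; []; _∷_; _++_; replicate)
open import Data.Vec.Functional as Vector using (Vector)
open import Function.Base using (_∘_)
open import Function.Bundles using (Inverse)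
import Function.Construct.Symmetry as Symmetry
open import Function.Definitions using (Congruent)
open import Function.Properties.Inverse using (Inverse⇒Injection)
open import Level using (_⊔_)
open import Relation.Binary.Definitions using (Decidable)
open import Relation.Binary.PropositionalEquality.Core as ≡ using (_≡_; _≢_)
import Relation.Binary.Reasoning.Setoid
open import Relation.Nullary.Decidable using (yes; no; dec-true; dec-false; via-injection)
open import Relation.Nullary.Negation using (¬_; contradiction)
open import Relation.Unary using (Pred; _≐_; _⊆_)
open import Relation.Unary.Properties using (≐-trans)

-- `cap` is defined on parameters, whereas the image of a circle is only a set of points. The
-- formula must therefore give the same value for every choice of parameters describing the image,
-- and this is why so much of the work goes into recovering a form from its points. The square in P²
-- / (D₁D₂) makes the quotient insensitive to the remaining freedom: scaling the two forms by s and
-- t multiplies P by st and D₁D₂ by s²t². Forms are pulled back along the adjugate of τ rather than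
-- its inverse. This avoids division, and the two results differ by the norm of det τ, a scalar from
-- GF(q). Conjugation is kept out of the computations: a quantity and its conjugate are treated as
-- independent variables, so that the behaviour of D and P is plain multiplicativity of
-- determinants, and `bar` enters only by substitution. Oddness of p enters when point sets are
-- compared, where averaging two opposite points of a circle and finding a base point on a line both
-- require halving.

-- Ring identities with integer coefficients

module IntegerRingSolver {c ℓ} (R : CommutativeRing c ℓ) where

  open CommutativeRing R
  open Algebra.Properties.Ring ring using (-‿distribˡ-*)
  open Algebra.Properties.Group +-group using (ε⁻¹≈ε; ⁻¹-involutive)
  open Algebra.Properties.AbelianGroup +-abelianGroup using (⁻¹-∙-comm)
  open Algebra.Properties.Semiring.Mult.TCOptimised semiring renaming (_×_ to _·_)
  open Relation.Binary.Reasoning.Setoid setoid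

  -- The optimised multiples send 0 and 1 to `0#` and `1#` by computation, so solver constants match
  -- these elements in goals without further rewriting. Integer coefficients have decidable
  -- equality, which an arbitrary ring need not have.
  fromℤ : ℤ → Carrier
  fromℤ (+ n)    = n · 1#
  fromℤ -[1+ n ] = - (suc n · 1#)

  fromℤ-⊖ : ∀ m n → fromℤ (m ⊖ n) ≈ m · 1# - n · 1#
  fromℤ-⊖ m zero = begin
    m · 1#       ≈⟨ +-identityʳ _ ⟨
    m · 1# + 0#  ≈⟨ +-congˡ ε⁻¹≈ε ⟨
    m · 1# - 0#  ∎
  fromℤ-⊖ zero    (suc n) = sym (+-identityˡ _)
  fromℤ-⊖ (suc m) (suc n) = begin
    fromℤ (suc m ⊖ suc n)                ≡⟨ ≡.cong fromℤ (ℤ.[1+m]⊖[1+n]≡m⊖n m n) ⟩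
    fromℤ (m ⊖ n)                        ≈⟨ fromℤ-⊖ m n ⟩
    m · 1# - n · 1#                      ≈⟨ +-congˡ (+-identityˡ _) ⟨
    m · 1# + (0# - n · 1#)               ≈⟨ +-congˡ (+-congʳ (-‿inverseʳ 1#)) ⟨
    m · 1# + ((1# - 1#) - n · 1#)        ≈⟨ +-congˡ (+-assoc _ _ _) ⟩
    m · 1# + (1# + (- 1# - n · 1#))      ≈⟨ +-assoc _ _ _ ⟨
    (m · 1# + 1#) + (- 1# - n · 1#)      ≈⟨ +-cong (trans (+-comm _ _) (sym (1+× m 1#))) (⁻¹-∙-comm _ _) ⟩
    suc m · 1# - (1# + n · 1#)           ≈⟨ +-congˡ (-‿cong (1+× n 1#)) ⟨
    suc m · 1# - suc n · 1#              ∎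

  fromℤ-+ : ∀ i j → fromℤ (i ℤ.+ j) ≈ fromℤ i + fromℤ j
  fromℤ-+ (+ m)    (+ n)    = ×-homo-+ 1# m n
  fromℤ-+ (+ m)    -[1+ n ] = fromℤ-⊖ m (suc n)
  fromℤ-+ -[1+ m ] (+ n)    = trans (fromℤ-⊖ n (suc m)) (+-comm _ _)
  fromℤ-+ -[1+ m ] -[1+ n ] = begin
    - (suc (suc (m ℕ.+ n)) · 1#)      ≡⟨ ≡.cong (λ k → - (k · 1#)) (ℕ.+-suc (suc m) n) ⟨
    - ((suc m ℕ.+ suc n) · 1#)        ≈⟨ -‿cong (×-homo-+ 1# (suc m) (suc n)) ⟩
    - (suc m · 1# + suc n · 1#)       ≈⟨ ⁻¹-∙-comm _ _ ⟨
    - (suc m · 1#) - (suc n · 1#)     ∎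

  fromℤ-neg : ∀ i → fromℤ (ℤ.- i) ≈ - fromℤ i
  fromℤ-neg (+ zero)  = sym ε⁻¹≈ε
  fromℤ-neg (+ suc n) = refl
  fromℤ-neg -[1+ n ]  = sym (⁻¹-involutive _)

  fromℤ-pos* : ∀ m j → fromℤ (+ m ℤ.* j) ≈ m · 1# * fromℤ j
  fromℤ-pos* m (+ n) = begin
    fromℤ (+ m ℤ.* + n)  ≡⟨ ≡.cong fromℤ (ℤ.pos-* m n) ⟨
    (m ℕ.* n) · 1#       ≈⟨ ×1-homo-* m n ⟩
    m · 1# * n · 1#      ∎
  fromℤ-pos* m -[1+ n ] = begin
    fromℤ (+ m ℤ.* -[1+ n ])        ≡⟨ ≡.cong fromℤ (ℤ.neg-distribʳ-* (+ m) (+ suc n)) ⟨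
    fromℤ (ℤ.- (+ m ℤ.* + suc n))   ≈⟨ fromℤ-neg (+ m ℤ.* + suc n) ⟩
    - fromℤ (+ m ℤ.* + suc n)       ≈⟨ -‿cong (fromℤ-pos* m (+ suc n)) ⟩
    - (m · 1# * suc n · 1#)         ≈⟨ -‿cong (*-comm _ _) ⟩
    - (suc n · 1# * m · 1#)         ≈⟨ -‿distribˡ-* _ _ ⟩
    - (suc n · 1#) * m · 1#         ≈⟨ *-comm _ _ ⟩
    m · 1# * - (suc n · 1#)         ∎

  fromℤ-* : ∀ i j → fromℤ (i ℤ.* j) ≈ fromℤ i * fromℤ j
  fromℤ-* (+ m)    j = fromℤ-pos* m j
  fromℤ-* -[1+ m ] j = begin
    fromℤ (-[1+ m ] ℤ.* j)        ≡⟨ ≡.cong fromℤ (ℤ.neg-distribˡ-* (+ suc m) j) ⟨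
    fromℤ (ℤ.- (+ suc m ℤ.* j))   ≈⟨ fromℤ-neg (+ suc m ℤ.* j) ⟩
    - fromℤ (+ suc m ℤ.* j)       ≈⟨ -‿cong (fromℤ-pos* (suc m) j) ⟩
    - (suc m · 1# * fromℤ j)      ≈⟨ -‿distribˡ-* _ _ ⟩
    - (suc m · 1#) * fromℤ j      ∎

  fromℤ-homomorphism : ℤ.+-*-rawRing -Raw-AlmostCommutative⟶ fromCommutativeRing R
  fromℤ-homomorphism = record
    { ⟦_⟧    = fromℤ
    ; +-homo = fromℤ-+
    ; *-homo = fromℤ-*
    ; -‿homo = fromℤ-neg
    ; 0-homo = refl
    ; 1-homo = refl
    }

  fromℤ-≟ : ∀ i j → Maybe (fromℤ i ≈ fromℤ j)
  fromℤ-≟ i j with i ℤ.≟ j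
  ... | yes i≡j = just (reflexive (≡.cong fromℤ i≡j))
  ... | no  _   = nothing

  open Algebra.Solver.Ring ℤ.+-*-rawRing (fromCommutativeRing R) fromℤ-homomorphism fromℤ-≟ public
    using (solve; _:=_; _:+_; _:*_; _:-_; :-_; con)

-- Divisibility of binomial coefficients

prime∣n!⇒p≤n : ∀ {p} → Prime p → ∀ n → p ∣ n ! → p ℕ.≤ n
prime∣n!⇒p≤n pr zero p∣1 = contradiction (∣⇒≤ p∣1) (ℕ.<⇒≱ (ℕ.nonTrivial⇒n>1 _ {{prime⇒nonTrivial pr}}))
prime∣n!⇒p≤n pr (suc n) p∣ with euclidsLemma (suc n) (n !) pr p∣
... | inj₁ p∣1+n = ∣⇒≤ p∣1+n
... | inj₂ p∣n!  = ℕ.m≤n⇒m≤1+n (prime∣n!⇒p≤n pr n p∣n!)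

-- `p` divides `p !`, which is the binomial coefficient times `k !` and `(p - k) !`. Both factorials
-- have arguments below `p`, so `p` divides neither of them.
prime∣pCk : ∀ {p k} → Prime p → 0 ℕ.< k → k ℕ.< p → p ∣ p choose k
prime∣pCk {p@(suc p-1)} {k} pr 0<k k<p
  with euclidsLemma (p choose k) (k ! ℕ.* (p ℕ.∸ k) !) pr p∣pCk*k![p-k]!
  where
  instance _ = k ℕ.!* (p ℕ.∸ k) !≢0
  k≤p = ℕ.<⇒≤ k<p
  p∣pCk*k![p-k]! : p ∣ (p choose k) ℕ.* (k ! ℕ.* (p ℕ.∸ k) !)
  p∣pCk*k![p-k]! = ≡.subst (p ∣_)
    (≡.sym (≡.trans (≡.cong (ℕ._* (k ! ℕ.* (p ℕ.∸ k) !)) (nCk≡n!/k![n-k]! k≤p)) (m/n*n≡m (k![n∸k]!∣n! k≤p))))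
    (m∣m*n (p-1 !))
... | inj₁ p∣pCk = p∣pCk
... | inj₂ p∣k![p-k]! with euclidsLemma (k !) ((p ℕ.∸ k) !) pr p∣k![p-k]!
...   | inj₁ p∣k!     = contradiction (prime∣n!⇒p≤n pr k p∣k!) (ℕ.<⇒≱ k<p)
...   | inj₂ p∣[p-k]! = contradiction (prime∣n!⇒p≤n pr (p ℕ.∸ k) p∣[p-k]!)
                          (ℕ.<⇒≱ (ℕ.∸-monoʳ-< 0<k (ℕ.<⇒≤ k<p)))

module _ {c ℓ} (M : CommutativeMonoid c ℓ) where
  open CommutativeMonoid M
  open Algebra.Properties.CommutativeMonoid.Sum M

  sum-single : ∀ {n} (t : Vector Carrier n) i → (∀ j → j ≢ i → t j ≈ ε) → sum t ≈ t i
  sum-single {suc n} t i t≈ε = trans (sum-remove {i = i} t)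
    (trans (∙-congˡ (trans (sum-cong-≋ (λ j → t≈ε (punchIn i j) (Fin.punchInᵢ≢i i j)))
                           (sum-replicate-zero n)))
           (identityʳ (t i)))

-- Polynomials over a field and the number of their roots

module FieldProperties {c ℓ} (F : Field c ℓ) where
  open Field F hiding (zero)
  open Algebra.Properties.Group +-group using (x∙y⁻¹≈ε⇒x≈y)
  open IntegerRingSolver commutativeRing
  open Relation.Binary.Reasoning.Setoid setoid

  *-cancelˡ-nonZero : ∀ x {y z} → x ≉ 0# → x * y ≈ x * z → y ≈ z
  *-cancelˡ-nonZero x {y} {z} x≉0 xy≈xz = begin
    y               ≈⟨ lemma y ⟨
    x ⁻¹ * (x * y)  ≈⟨ *-congˡ xy≈xz ⟩
    x ⁻¹ * (x * z)  ≈⟨ lemma z ⟩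
    z               ∎
    where
    lemma : ∀ w → x ⁻¹ * (x * w) ≈ w
    lemma w = begin
      x ⁻¹ * (x * w)  ≈⟨ solve 3 (λ x x⁻¹ w → x⁻¹ :* (x :* w) := (x :* x⁻¹) :* w) refl x (x ⁻¹) w ⟩
      x * x ⁻¹ * w    ≈⟨ *-congʳ (inverseʳ x x≉0) ⟩
      1# * w          ≈⟨ *-identityˡ w ⟩
      w               ∎

  xy≈0⇒y≈0 : ∀ x {y} → x ≉ 0# → x * y ≈ 0# → y ≈ 0#
  xy≈0⇒y≈0 x x≉0 xy≈0 = *-cancelˡ-nonZero x x≉0 (trans xy≈0 (sym (zeroʳ x)))

  *-nonZero : ∀ {x y} → x ≉ 0# → y ≉ 0# → x * y ≉ 0#
  *-nonZero x≉0 y≉0 xy≈0 = y≉0 (xy≈0⇒y≈0 _ x≉0 xy≈0)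

  x≉y⇒x-y≉0 : ∀ {x y} → x ≉ y → x - y ≉ 0#
  x≉y⇒x-y≉0 x≉y x-y≈0 = x≉y (x∙y⁻¹≈ε⇒x≈y _ _ x-y≈0)

  -- The monic polynomial a₀ + a₁x + … + aₙ₋₁xⁿ⁻¹ + xⁿ; the coefficient
  -- vector omits the leading 1.
  monic : ∀ {n} → Vec Carrier n → Carrier → Carrier
  monic []       x = 1#
  monic (a ∷ as) x = a + x * monic as x

  -- Synthetic division by x - r, for the polynomial whose coefficients above
  -- the constant one are as.
  quotient : ∀ {n} → Vec Carrier n → Carrier → Vec Carrier n
  quotient []       r = []
  quotient (a ∷ as) r = monic (a ∷ as) r ∷ quotient as r

  -- The constant coefficient is absent because it cancels in the difference of the values at `x`
  -- and `r`. Inserting `x * mr` splits off one factor `x - r` and leaves the same problem in lower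
  -- degree.
  monic-quotient : ∀ {n} (as : Vec Carrier n) r x →
    x * monic as x - r * monic as r ≈ (x - r) * monic (quotient as r) x
  monic-quotient [] r x =
    solve 2 (λ r x → x :* con (+ 1) :- r :* con (+ 1) := (x :- r) :* con (+ 1)) refl r x
  monic-quotient as@(_ ∷ as′) r x = begin
    x * mx - r * mr                  ≈⟨ solve 4 (λ x r mx mr → x :* mx :- r :* mr := (x :- r) :* mr :+ x :* (mx :- mr)) refl x r mx mr ⟩
    (x - r) * mr + x * (mx - mr)     ≈⟨ +-congˡ (*-congˡ mx-mr) ⟩
    (x - r) * mr + x * ((x - r) * Q) ≈⟨ solve 4 (λ x r mr Q → (x :- r) :* mr :+ x :* ((x :- r) :* Q) := (x :- r) :* (mr :+ x :* Q)) refl x r mr Q ⟩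
    (x - r) * (mr + x * Q)           ∎
    where
    mx = monic as x
    mr = monic as r
    Q  = monic (quotient as′ r) x
    mx-mr : mx - mr ≈ (x - r) * Q
    mx-mr = trans
      (solve 3 (λ a y z → (a :+ y) :- (a :+ z) := y :- z) refl _ (x * monic as′ x) (r * monic as′ r))
      (monic-quotient as′ r x)

  Distinct : ∀ {n} → (Fin n → Carrier) → Set ℓ
  Distinct r = ∀ i j → i ≢ j → r i ≉ r j

  -- Induction on the degree: `r zero` is divided out, and the other roots, being different from it,
  -- are roots of the quotient. In degree 0 only the constant 1 is left, which has no root.
  monic-¬tooManyRoots : ∀ {n} (as : Vec Carrier n) (r : Fin (suc n) → Carrier) →
    Distinct r → ¬ (∀ i → monic as (r i) ≈ 0#)
  monic-¬tooManyRoots []       r _   root = 0≉1 (sym (root zero))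
  monic-¬tooManyRoots (a ∷ as) r r-≉ root =
    monic-¬tooManyRoots (quotient as r₀) (r ∘ suc)
      (λ i j i≢j → r-≉ (suc i) (suc j) (i≢j ∘ Fin.suc-injective))
      (λ i → xy≈0⇒y≈0 _ (x≉y⇒x-y≉0 (r-≉ (suc i) zero λ ()))
        (let x = r (suc i) in begin
          (x - r₀) * monic (quotient as r₀) x              ≈⟨ monic-quotient as r₀ x ⟨
          x * monic as x - r₀ * monic as r₀                ≈⟨ solve 3 (λ a y z → y :- z := (a :+ y) :- (a :+ z)) refl a _ _ ⟩
          (a + x * monic as x) - (a + r₀ * monic as r₀)    ≈⟨ +-cong (root (suc i)) (-‿cong (root zero)) ⟩
          0# - 0#                                          ≈⟨ -‿inverseʳ 0# ⟩
          0#                                               ∎))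
    where r₀ = r zero

-- Finite fields: Fermat's little theorem and the characteristic

module FiniteField {c ℓ} (F : Field c ℓ) {n : ℕ} (order : HasOrder F n) where
  open Field F hiding (zero)
  open FieldProperties F
  open IntegerRingSolver commutativeRing
  open Algebra.Properties.CommutativeSemiring.Exp commutativeSemiring
  open Algebra.Properties.Semiring.Mult semiring renaming (_×_ to _·_)
  open Algebra.Properties.Group +-group using (identityʳ-unique)
  open Relation.Binary.Reasoning.Setoid setoid
  module Σ = Algebra.Properties.CommutativeMonoid.Sum +-commutativeMonoid
  module Π = Algebra.Properties.CommutativeMonoid.Sum *-commutativeMonoid

  open Inverse order public using () renaming (to to element; from to index; from-cong to index-cong; strictlyInverseˡ to element-index; strictlyInverseʳ to index-element)

  _≟_ : Decidable _≈_
  _≟_ = via-injection (Inverse⇒Injection (Symmetry.inverse order)) Fin._≟_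

  element-distinct : Distinct element
  element-distinct i j i≢j ei≈ej = i≢j
    (≡.trans (≡.sym (index-element i)) (≡.trans (index-cong ei≈ej) (index-element j)))

  ≢index⇒≉ : ∀ {i x} → i ≢ index x → element i ≉ x
  ≢index⇒≉ i≢ ei≈x = i≢ (≡.trans (≡.sym (index-element _)) (index-cong ei≈x))

  bijection⇒permutation : (f g : Carrier → Carrier) → Congruent _≈_ _≈_ f → Congruent _≈_ _≈_ g →
    (∀ x → f (g x) ≈ x) → (∀ x → g (f x) ≈ x) → Permutation′ n
  bijection⇒permutation f g f-cong g-cong fg gf = permutation
    (index ∘ f ∘ element) (index ∘ g ∘ element)
    (inverse f g f-cong fg) (inverse g f g-cong gf)
    where
    inverse : ∀ f g → Congruent _≈_ _≈_ f → (∀ x → f (g x) ≈ x) →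
              ∀ i → index (f (element (index (g (element i))))) ≡ i
    inverse f g f-cong fg i = ≡.trans
      (index-cong (trans (f-cong (element-index _)) (fg (element i))))
      (index-element i)

  -- Translation by 1 permutes the elements, so their sum is unchanged when 1 is added to each of
  -- the `n` summands.
  n·1≈0 : n · 1# ≈ 0#
  n·1≈0 = identityʳ-unique (Σ.sum element) (n · 1#) (sym (begin
    Σ.sum element                                   ≈⟨ Σ.sum-permute element shift ⟩
    Σ.sum (λ i → element (index (element i + 1#)))  ≈⟨ Σ.sum-cong-≋ (λ i → element-index (element i + 1#)) ⟩
    Σ.sum (λ i → element i + 1#)                    ≈⟨ Σ.∑-distrib-+ element (Vector.replicate n 1#) ⟩
    Σ.sum element + Σ.sum (Vector.replicate n 1#)          ≈⟨ +-congˡ (Σ.sum-replicate n) ⟩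
    Σ.sum element + n · 1#                          ∎))
    where
    shift : Permutation′ n
    shift = bijection⇒permutation (_+ 1#) (_- 1#) +-congʳ +-congʳ
      (solve 1 (λ x → (x :- con (+ 1)) :+ con (+ 1) := x) refl)
      (solve 1 (λ x → (x :+ con (+ 1)) :- con (+ 1) := x) refl)

  -- The product of all nonzero elements is invariant under multiplication by
  -- x.  The factor at 0 is replaced by 1, and the correction for it is the
  -- single factor x.
  private
    unit : Carrier → Carrier
    unit y with y ≟ 0#
    ... | yes _ = 1#
    ... | no  _ = y

    unit-cong : Congruent _≈_ _≈_ unit
    unit-cong {x} {y} x≈y with x ≟ 0# | y ≟ 0#
    ... | yes _   | yes _   = refl
    ... | yes x≈0 | no  y≉0 = contradiction (trans (sym x≈y) x≈0) y≉0
    ... | no  x≉0 | yes y≈0 = contradiction (trans x≈y y≈0) x≉0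
    ... | no  _   | no  _   = x≈y

    unit-nonZero : ∀ y → unit y ≉ 0#
    unit-nonZero y with y ≟ 0#
    ... | yes _   = 0≉1 ∘ sym
    ... | no  y≉0 = y≉0

    ∏-nonZero : ∀ {m} (t : Vector Carrier m) → (∀ i → t i ≉ 0#) → Π.sum t ≉ 0#
    ∏-nonZero {zero}  t t≉0 = 0≉1 ∘ sym
    ∏-nonZero {suc m} t t≉0 = *-nonZero (t≉0 zero) (∏-nonZero (t ∘ suc) (t≉0 ∘ suc))

    correction : Carrier → Carrier → Carrier
    correction x y with y ≟ 0#
    ... | yes _ = x
    ... | no  _ = 1#

    correction-zero : ∀ x {y} → y ≈ 0# → correction x y ≈ x
    correction-zero x {y} y≈0 with y ≟ 0#
    ... | yes _   = refl
    ... | no  y≉0 = contradiction y≈0 y≉0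

    correction-nonZero : ∀ x {y} → y ≉ 0# → correction x y ≈ 1#
    correction-nonZero x {y} y≉0 with y ≟ 0#
    ... | yes y≈0 = contradiction y≈0 y≉0
    ... | no  _   = refl

    unit-* : ∀ {x} → x ≉ 0# → ∀ y → correction x y * unit (x * y) ≈ x * unit y
    unit-* {x} x≉0 y with y ≟ 0# | (x * y) ≟ 0#
    ... | yes _   | yes _    = refl
    ... | yes y≈0 | no  xy≉0 = contradiction (trans (*-congˡ y≈0) (zeroʳ x)) xy≉0
    ... | no  y≉0 | yes xy≈0 = contradiction xy≈0 (*-nonZero x≉0 y≉0)
    ... | no  _   | no  _    = *-identityˡ (x * y)

  -- Fermat's little theorem with exponent `n` instead of `n - 1`: every element, zero included,
  -- contributes a factor `x`, and the corrections multiply to the `x` on the right. In this form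
  -- the theorem also holds at 0.
  x^n≈x : ∀ x → x ^ n ≈ x
  x^n≈x x with x ≟ 0#
  ... | yes x≈0 = begin
    x ^ n   ≈⟨ ^-congˡ n x≈0 ⟩
    -- The index of `0#` shows that `Fin n` is inhabited, so `n` is not 0.
    0# ^ n  ≈⟨ 0^n n (index 0#) ⟩
    0#      ≈⟨ x≈0 ⟨
    x       ∎
    where
    0^n : ∀ m → Fin m → 0# ^ m ≈ 0#
    0^n (suc m) _ = zeroˡ _
  ... | no x≉0 = begin
    x ^ n                           ≈⟨ *-cancelˡ-nonZero U U≉0 U*k≈U*x^n ⟨
    Π.sum (correction x ∘ element)  ≈⟨ sum-single *-commutativeMonoid _ (index 0#)
                                         (λ i i≢ → correction-nonZero x (≢index⇒≉ i≢)) ⟩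
    correction x (element (index 0#)) ≈⟨ correction-zero x (element-index 0#) ⟩
    x                               ∎
    where
    U = Π.sum (unit ∘ element)
    U≉0 : U ≉ 0#
    U≉0 = ∏-nonZero _ (unit-nonZero ∘ element)

    scale : Permutation′ n
    scale = bijection⇒permutation (x *_) (x ⁻¹ *_) *-congˡ *-congˡ
      (λ y → trans (sym (*-assoc _ _ _)) (trans (*-congʳ (inverseʳ x x≉0)) (*-identityˡ y)))
      (λ y → trans (sym (*-assoc _ _ _)) (trans (*-congʳ (trans (*-comm _ _) (inverseʳ x x≉0))) (*-identityˡ y)))

    U≈ : U ≈ Π.sum (λ i → unit (x * element i))
    U≈ = trans (Π.sum-permute (unit ∘ element) scale)
      (Π.sum-cong-≋ (λ i → unit-cong (element-index (x * element i))))

    U*k≈U*x^n : U * Π.sum (correction x ∘ element) ≈ U * x ^ n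
    U*k≈U*x^n = begin
      U * Π.sum (correction x ∘ element)                                       ≈⟨ *-comm _ _ ⟩
      Π.sum (correction x ∘ element) * U                                       ≈⟨ *-congˡ U≈ ⟩
      Π.sum (correction x ∘ element) * Π.sum (λ i → unit (x * element i))      ≈⟨ Π.∑-distrib-+ (correction x ∘ element) _ ⟨
      Π.sum (λ i → correction x (element i) * unit (x * element i))            ≈⟨ Π.sum-cong-≋ (unit-* x≉0 ∘ element) ⟩
      Π.sum (λ i → x * unit (element i))                                       ≈⟨ Π.∑-distrib-+ (Vector.replicate n x) _ ⟩
      Π.sum (Vector.replicate n x) * U                                                ≈⟨ *-congʳ (Π.sum-replicate n) ⟩
      x ^ n * U                                                                ≈⟨ *-comm _ _ ⟩
      U * x ^ n                                                                ∎

  -- The multiple p^k · 1 is the k-th power of p · 1, and a field has no zero divisors.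
  characteristic : ∀ p k → n ≡ p ℕ.^ k → p · 1# ≈ 0#
  characteristic p k n≡p^k = go k (trans (×-congˡ (≡.sym n≡p^k)) n·1≈0)
    where
    go : ∀ k → (p ℕ.^ k) · 1# ≈ 0# → p · 1# ≈ 0#
    go zero    1≈0     = contradiction (trans (sym 1≈0) (+-identityʳ 1#)) 0≉1
    go (suc k) p^1+k≈0 with (p · 1#) ≟ 0#
    ... | yes p≈0 = p≈0
    ... | no  p≉0 = go k (xy≈0⇒y≈0 _ p≉0 (trans (sym (×1-homo-* p (p ℕ.^ k))) p^1+k≈0))

-- Additivity of the Frobenius map

module Frobenius {c ℓ} (R : CommutativeRing c ℓ) where
  open CommutativeRing R hiding (zero)
  open Algebra.Properties.Semiring.Mult semiring renaming (_×_ to _·_)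
  open Algebra.Properties.CommutativeSemiring.Exp commutativeSemiring
  module Binomial = Algebra.Properties.CommutativeSemiring.Binomial commutativeSemiring
  open Algebra.Properties.CommutativeMonoid.Sum +-commutativeMonoid
  open Relation.Binary.Reasoning.Setoid setoid

  module _ {p : ℕ} (p-prime : Prime p) (p·1≈0 : p · 1# ≈ 0#) where

    ∣⇒·≈0 : ∀ {k} x → p ∣ k → k · x ≈ 0#
    ∣⇒·≈0 x (divides q ≡.refl) = begin
      (q ℕ.* p) · x           ≈⟨ ×-congʳ (q ℕ.* p) (*-identityˡ x) ⟨
      (q ℕ.* p) · (1# * x)    ≈⟨ ×-assoc-* (q ℕ.* p) 1# x ⟨
      ((q ℕ.* p) · 1#) * x    ≈⟨ *-congʳ (×1-homo-* q p) ⟩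
      (q · 1#) * (p · 1#) * x ≈⟨ *-congʳ (*-congˡ p·1≈0) ⟩
      (q · 1#) * 0# * x       ≈⟨ *-congʳ (zeroʳ _) ⟩
      0# * x                  ≈⟨ zeroˡ x ⟩
      0#                      ∎

    -- In the binomial expansion `p` divides every coefficient except the two outer ones.
    ^p-+ : ∀ x y → (x + y) ^ p ≈ x ^ p + y ^ p
    ^p-+ x y = go p ≡.refl
      where
      -- The hypotheses fix `p`; its copy `p′` can be split into a successor, which exposes the
      -- first and the last term of the sum.
      go : ∀ p′ → p′ ≡ p → (x + y) ^ p′ ≈ x ^ p′ + y ^ p′
      go zero    ≡.refl = contradiction (ℕ.nonTrivial⇒n>1 _ {{prime⇒nonTrivial p-prime}}) λ ()
      go (suc k) ≡.refl = begin
        (x + y) ^ suc k                            ≈⟨ Binomial.theorem (suc k) x y ⟩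
        sum t                                      ≡⟨⟩
        t zero + sum (t ∘ suc)                     ≈⟨ +-cong first (sum-init-last (t ∘ suc)) ⟩
        y ^ suc k + (sum (t ∘ suc ∘ inject₁) + t (suc (fromℕ k)))
                                                   ≈⟨ +-congˡ (+-cong (trans (sum-cong-≋ middle) (sum-replicate-zero k)) last) ⟩
        y ^ suc k + (0# + x ^ suc k)               ≈⟨ +-congˡ (+-identityˡ _) ⟩
        y ^ suc k + x ^ suc k                      ≈⟨ +-comm _ _ ⟩
        x ^ suc k + y ^ suc k                      ∎
        where
        t : Vector Carrier (suc (suc k))
        t = Binomial.binomialTerm x y (suc k)

        first : t zero ≈ y ^ suc k
        first = trans (+-identityʳ _) (*-identityˡ _)

        middle : ∀ i → t (suc (inject₁ i)) ≈ 0#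
        middle i = ∣⇒·≈0 _ (prime∣pCk p-prime (ℕ.s≤s ℕ.z≤n)
          (ℕ.s≤s (≡.subst (ℕ._< k) (≡.sym (Fin.toℕ-inject₁ i)) (Fin.toℕ<n i))))

        last : t (suc (fromℕ k)) ≈ x ^ suc k
        last rewrite Fin.toℕ-fromℕ k | nCn≡1 (suc k) | ℕ.n∸n≡0 k =
          trans (+-identityʳ _) (*-identityʳ _)

    ^p^m-+ : ∀ m x y → (x + y) ^ (p ℕ.^ m) ≈ x ^ (p ℕ.^ m) + y ^ (p ℕ.^ m)
    ^p^m-+ zero x y = trans (*-identityʳ _) (sym (+-cong (*-identityʳ x) (*-identityʳ y)))
    ^p^m-+ (suc m) x y = begin
      (x + y) ^ (p ℕ.* q)              ≈⟨ ^-assocʳ (x + y) p q ⟨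
      ((x + y) ^ p) ^ q                ≈⟨ ^-congˡ q (^p-+ x y) ⟩
      (x ^ p + y ^ p) ^ q              ≈⟨ ^p^m-+ m (x ^ p) (y ^ p) ⟩
      (x ^ p) ^ q + (y ^ p) ^ q        ≈⟨ +-cong (^-assocʳ x p q) (^-assocʳ y p q) ⟩
      x ^ (p ℕ.* q) + y ^ (p ℕ.* q)    ∎
      where q = p ℕ.^ m

-- Provides q + 1 distinct elements in a field of order q², one more than x^q = x can have
-- solutions.
2≤n⇒1+n≤n² : ∀ {n} → 2 ℕ.≤ n → suc n ℕ.≤ n ℕ.^ 2
2≤n⇒1+n≤n² {n} 2≤n = begin
  suc n    ≤⟨ ℕ.+-monoˡ-≤ n (ℕ.≤-trans (s≤s z≤n) 2≤n) ⟩
  n ℕ.+ n  ≡⟨ ≡.cong (n ℕ.+_) (ℕ.+-identityʳ n) ⟨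
  2 ℕ.* n  ≤⟨ ℕ.*-monoˡ-≤ n 2≤n ⟩
  n ℕ.* n  ≡⟨ ≡.cong (n ℕ.*_) (ℕ.*-identityʳ n) ⟨
  n ℕ.^ 2  ∎
  where open ℕ.≤-Reasoning

2≤p^m : ∀ {p m} → Prime p → 1 ℕ.≤ m → 2 ℕ.≤ p ℕ.^ m
2≤p^m {p} {m} p-prime 1≤m = begin
  2        ≤⟨ ℕ.nonTrivial⇒n>1 p {{prime⇒nonTrivial p-prime}} ⟩
  p        ≡⟨ ℕ.^-identityʳ p ⟨
  p ℕ.^ 1  ≤⟨ ℕ.^-monoʳ-≤ p {{prime⇒nonZero p-prime}} 1≤m ⟩
  p ℕ.^ m  ∎
  where open ℕ.≤-Reasoning

-- The polynomials needed for fixed points and norms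

module RootCounting {c ℓ} (F : Field c ℓ) where
  open Field F hiding (zero)
  open FieldProperties F
  open IntegerRingSolver commutativeRing
  open Algebra.Properties.CommutativeSemiring.Exp commutativeSemiring
  open Relation.Binary.Reasoning.Setoid setoid

  monic-shift : ∀ k {n} (as : Vec Carrier n) x → monic (replicate k 0# ++ as) x ≈ x ^ k * monic as x
  monic-shift zero    as x = sym (*-identityˡ _)
  monic-shift (suc k) as x = begin
    0# + x * monic (replicate k 0# ++ as) x  ≈⟨ +-identityˡ _ ⟩
    x * monic (replicate k 0# ++ as) x       ≈⟨ *-congˡ (monic-shift k as x) ⟩
    x * (x ^ k * monic as x)                 ≈⟨ *-assoc _ _ _ ⟨
    x ^ suc k * monic as x                   ∎

  monic-replicate : ∀ k x → monic (replicate k 0#) x ≈ x ^ k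
  monic-replicate zero    x = refl
  monic-replicate (suc k) x = trans (+-identityˡ _) (*-congˡ (monic-replicate k x))

  x^n≈x-¬tooManyRoots : ∀ {n} → 2 ℕ.≤ n → (r : Fin (suc n) → Carrier) → Distinct r →
    ¬ (∀ i → r i ^ n ≈ r i)
  x^n≈x-¬tooManyRoots {suc (suc k)} (s≤s (s≤s z≤n)) r r-≉ fixed =
    -- These are the coefficients of X^n - X below the leading one. The bound 2 ≤ n keeps the linear
    -- term apart from the leading term.
    monic-¬tooManyRoots (0# ∷ - 1# ∷ replicate k 0#) r r-≉ (λ i → root (r i) (fixed i))
    where
    root : ∀ x → x ^ suc (suc k) ≈ x → monic (0# ∷ - 1# ∷ replicate k 0#) x ≈ 0#
    root x x^n≈x = begin
      0# + x * (- 1# + x * monic (replicate k 0#) x)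
        ≈⟨ +-congˡ (*-congˡ (+-congˡ (*-congˡ (monic-replicate k x)))) ⟩
      0# + x * (- 1# + x * x ^ k)
        ≈⟨ solve 2 (λ x y → con (+ 0) :+ x :* (:- con (+ 1) :+ x :* y) := x :* (x :* y) :- x) refl x (x ^ k) ⟩
      x ^ suc (suc k) - x
        ≈⟨ +-congʳ x^n≈x ⟩
      x - x
        ≈⟨ -‿inverseʳ x ⟩
      0# ∎

  -- The sum of c^(k-i) y^i for i from 0 to k, in Horner form: the quotient of y^(k+1) - c^(k+1) by
  -- y - c.
  geometric : Carrier → ℕ → Carrier → Carrier
  geometric c zero    y = 1#
  geometric c (suc k) y = c ^ suc k + y * geometric c k y

  [y-c]*geometric : ∀ c k y → (y - c) * geometric c k y ≈ y ^ suc k - c ^ suc k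
  [y-c]*geometric c zero y = solve 2 (λ c y → (y :- c) :* con (+ 1) := y :* con (+ 1) :- c :* con (+ 1)) refl c y
  [y-c]*geometric c (suc k) y = begin
    (y - c) * (c ^ suc k + y * G)           ≈⟨ solve 4 (λ y c d G → (y :- c) :* (d :+ y :* G) := (y :- c) :* d :+ y :* ((y :- c) :* G)) refl y c (c ^ suc k) G ⟩
    (y - c) * c ^ suc k + y * ((y - c) * G) ≈⟨ +-congˡ (*-congˡ ([y-c]*geometric c k y)) ⟩
    (y - c) * c ^ suc k + y * (y ^ suc k - c ^ suc k) ≈⟨ solve 4 (λ y c d e → (y :- c) :* d :+ y :* (e :- d) := y :* e :- c :* d) refl y c (c ^ suc k) (y ^ suc k) ⟩
    y ^ suc (suc k) - c ^ suc (suc k)       ∎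
    where G = geometric c k y

  -- Coefficients in x of `geometric c k` evaluated at x^(q+1). Each block of q zeros separates
  -- consecutive powers of x^(q+1), and the length k(q+1) is the degree.
  geometricNorm : ∀ (c : Carrier) q k → Vec Carrier (k ℕ.* suc q)
  geometricNorm c q zero    = []
  geometricNorm c q (suc k) = c ^ suc k ∷ (replicate q 0# ++ geometricNorm c q k)

  monic-geometricNorm : ∀ c q k x → monic (geometricNorm c q k) x ≈ geometric c k (x * x ^ q)
  monic-geometricNorm c q zero    x = refl
  monic-geometricNorm c q (suc k) x = +-congˡ (begin
    x * monic (replicate q 0# ++ geometricNorm c q k) x  ≈⟨ *-congˡ (monic-shift q (geometricNorm c q k) x) ⟩
    x * (x ^ q * monic (geometricNorm c q k) x)          ≈⟨ *-assoc _ _ _ ⟨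
    x * x ^ q * monic (geometricNorm c q k) x            ≈⟨ *-congˡ (monic-geometricNorm c q k x) ⟩
    x * x ^ q * geometric c k (x * x ^ q)                ∎)

-- The norm in a field of order q²

module SquareOrder {c ℓ} (F : Field c ℓ) {q : ℕ} (2≤q : 2 ℕ.≤ q) (order : HasOrder F (q ℕ.^ 2)) where
  open Field F hiding (zero)
  open FieldProperties F
  open FiniteField F order
  open RootCounting F
  open Algebra.Properties.CommutativeSemiring.Exp commutativeSemiring
  open Relation.Binary.Reasoning.Setoid setoid

  element-inject≤-distinct : ∀ {k} (k≤q² : k ℕ.≤ q ℕ.^ 2) → Distinct (λ i → element (inject≤ i k≤q²))
  element-inject≤-distinct k≤q² i j i≢j =
    element-distinct _ _ (i≢j ∘ Fin.inject≤-injective k≤q² k≤q² i j)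

  ^q-involutive : ∀ x → (x ^ q) ^ q ≈ x
  ^q-involutive x = begin
    (x ^ q) ^ q    ≈⟨ ^-assocʳ x q q ⟩
    x ^ (q ℕ.* q)  ≡⟨ ≡.cong (λ k → x ^ (q ℕ.* k)) (ℕ.*-identityʳ q) ⟨
    x ^ (q ℕ.^ 2)  ≈⟨ x^n≈x x ⟩
    x              ∎

  ∃-nonFixed : ∃ λ x → x ^ q ≉ x
  ∃-nonFixed with Fin.¬∀⟶∃¬ (q ℕ.^ 2) (λ i → element i ^ q ≈ element i) (λ i → (element i ^ q) ≟ element i)
    (λ fixed → x^n≈x-¬tooManyRoots 2≤q _ (element-inject≤-distinct 1+q≤q²) (λ i → fixed (inject≤ i 1+q≤q²)))
    where
    1+q≤q² = 2≤n⇒1+n≤n² 2≤q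
  ... | i , ¬fixed = element i , ¬fixed

  -- If c is not a norm, then every x is a root of x·G(x^(q+1)), where
  -- G(y) = (y^(q-1) - c^(q-1)) / (y - c); but its degree is less than q².
  norm-surjective : ∀ {c} → c ≉ 0# → c ^ q ≈ c → ∃ λ w → w * w ^ q ≈ c
  norm-surjective {c} c≉0 c^q≈c with Fin.any? (λ i → (element i * element i ^ q) ≟ c)
  ... | yes (i , norm≈c) = element i , norm≈c
  ... | no  ¬norm        = ⊥-elim (go ≡.refl 2≤q)
    where
    norm≉c : ∀ x → x * x ^ q ≉ c
    norm≉c x norm≈c = ¬norm (index x ,
      trans (*-cong (element-index x) (^-congˡ q (element-index x))) norm≈c)

    norm-fixed : ∀ x → (x * x ^ q) ^ q ≈ x * x ^ q
    norm-fixed x = begin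
      (x * x ^ q) ^ q       ≈⟨ ^-distrib-* x (x ^ q) q ⟩
      x ^ q * (x ^ q) ^ q   ≈⟨ *-congˡ (^q-involutive x) ⟩
      x ^ q * x             ≈⟨ *-comm _ _ ⟩
      x * x ^ q             ∎

    ^q-nonZero : ∀ {x} → x ≉ 0# → x ^ q ≉ 0#
    ^q-nonZero x≉0 x^q≈0 = x≉0 (trans (sym (^q-involutive _)) (trans (^-congˡ q x^q≈0) (0^q q 2≤q)))
      where
      0^q : ∀ q → 2 ℕ.≤ q → 0# ^ q ≈ 0#
      0^q (suc q) _ = zeroˡ _

    go : ∀ {q′} → q′ ≡ q → 2 ℕ.≤ q′ → ⊥
    go {suc (suc k)} ≡.refl (s≤s (s≤s z≤n)) =
      monic-¬tooManyRoots (0# ∷ geometricNorm c q k) (λ i → element (inject≤ i bound))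
        (element-inject≤-distinct bound) (λ i → root (element (inject≤ i bound)))
      where
      bound : suc (suc (k ℕ.* suc q)) ℕ.≤ q ℕ.^ 2
      bound = ≡.subst (suc (suc (k ℕ.* suc q)) ℕ.≤_)
        (solve 1 (λ k → con 2 :+ k :* (con 3 :+ k) :+ (k :+ con 2) := (con 2 :+ k) :* ((con 2 :+ k) :* con 1)) ≡.refl k)
        (ℕ.m≤m+n (suc (suc (k ℕ.* suc q))) (k ℕ.+ 2))
        where open +-*-Solver

      fixed⇒^≈1 : ∀ {y} → y ≉ 0# → y ^ q ≈ y → y ^ suc k ≈ 1#
      fixed⇒^≈1 {y} y≉0 y^q≈y = *-cancelˡ-nonZero y y≉0 (trans y^q≈y (sym (*-identityʳ y)))

      root : ∀ x → 0# + x * monic (geometricNorm c q k) x ≈ 0#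
      root x with x ≟ 0#
      -- The extra factor `x` of the polynomial serves this case: the norm of 0 is 0, and its power
      -- `suc k` is not 1.
      ... | yes x≈0 = trans (+-identityˡ _) (trans (*-congʳ x≈0) (zeroˡ _))
      ... | no  x≉0 = begin
        0# + x * monic (geometricNorm c q k) x  ≈⟨ +-identityˡ _ ⟩
        x * monic (geometricNorm c q k) x       ≈⟨ *-congˡ (monic-geometricNorm c q k x) ⟩
        x * geometric c k (x * x ^ q)           ≈⟨ *-congˡ geometric≈0 ⟩
        x * 0#                                  ≈⟨ zeroʳ x ⟩
        0#                                      ∎
        where
        N = x * x ^ q
        geometric≈0 : geometric c k N ≈ 0#
        geometric≈0 = xy≈0⇒y≈0 (N - c) (x≉y⇒x-y≉0 (norm≉c x)) (begin
          (N - c) * geometric c k N  ≈⟨ [y-c]*geometric c k N ⟩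
          N ^ suc k - c ^ suc k      ≈⟨ +-cong (fixed⇒^≈1 (*-nonZero x≉0 (^q-nonZero x≉0)) (norm-fixed x))
                                              (-‿cong (fixed⇒^≈1 c≉0 c^q≈c)) ⟩
          1# - 1#                    ≈⟨ -‿inverseʳ 1# ⟩
          0#                         ∎)

odd-prime⇒≡1+2j : ∀ {p} → Prime p → p ≢ 2 → ∃ λ j → p ≡ suc (j ℕ.* 2)
odd-prime⇒≡1+2j {p} p-prime p≢2 with p ℕ.% 2 | m%n<n p 2 | m≡m%n+[m/n]*n p 2
... | 0 | _ | p≡ with prime⇒irreducible p-prime (divides (p ℕ./ 2) p≡)
...   | inj₂ 2≡p = contradiction (≡.sym 2≡p) p≢2
odd-prime⇒≡1+2j {p} _ _ | 1 | _ | p≡ = p ℕ./ 2 , p≡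
odd-prime⇒≡1+2j _ _ | suc (suc _) | s≤s (s≤s ()) | _

-- Bilinear forms in two variables and their determinants

module BilinearIdentities {c ℓ} (R : CommutativeRing c ℓ) where
  open CommutativeRing R
  open IntegerRingSolver R

  -- The row (x y) times the matrix with rows (α β) and (β′ γ) times the column (z w). For a
  -- Hermitian form, β′ and the row vector are later replaced by conjugates.
  bilinear : (α β β′ γ x y z w : Carrier) → Carrier
  bilinear α β β′ γ x y z w = x * (α * z + β * w) + y * (β′ * z + γ * w)

  private
    :bilinear = λ {n} α β β′ γ x y z w → _:+_ {n} (x :* (α :* z :+ β :* w)) (y :* (β′ :* z :+ γ :* w))

  bilinear-cong : ∀ α β β′ γ {x x′ y y′ z z′ w w′} → x ≈ x′ → y ≈ y′ → z ≈ z′ → w ≈ w′ →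
    bilinear α β β′ γ x y z w ≈ bilinear α β β′ γ x′ y′ z′ w′
  bilinear-cong α β β′ γ x y z w = +-cong
    (*-cong x (+-cong (*-congˡ z) (*-congˡ w)))
    (*-cong y (+-cong (*-congˡ z) (*-congˡ w)))

  bilinear-congᶜ : ∀ {α α₁ β β₁ β′ β₁′ γ γ₁} x y z w → α ≈ α₁ → β ≈ β₁ → β′ ≈ β₁′ → γ ≈ γ₁ →
    bilinear α β β′ γ x y z w ≈ bilinear α₁ β₁ β₁′ γ₁ x y z w
  bilinear-congᶜ x y z w α β β′ γ = +-cong
    (*-congˡ (+-cong (*-congʳ α) (*-congʳ β)))
    (*-congˡ (+-cong (*-congʳ β′) (*-congʳ γ)))

  bilinear-scale : ∀ α β β′ γ s t x y z w →
    bilinear α β β′ γ (s * x) (s * y) (t * z) (t * w) ≈ (t * s) * bilinear α β β′ γ x y z w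
  bilinear-scale = solve 10 (λ α β β′ γ s t x y z w →
    :bilinear α β β′ γ (s :* x) (s :* y) (t :* z) (t :* w) := (t :* s) :* :bilinear α β β′ γ x y z w) refl

  bilinear-scaleᶜ : ∀ t α β β′ γ x y z w →
    bilinear (t * α) (t * β) (t * β′) (t * γ) x y z w ≈ t * bilinear α β β′ γ x y z w
  bilinear-scaleᶜ = solve 9 (λ t α β β′ γ x y z w →
    :bilinear (t :* α) (t :* β) (t :* β′) (t :* γ) x y z w := t :* :bilinear α β β′ γ x y z w) refl

  bilinear-transpose : ∀ α β β′ γ x y z w → bilinear α β β′ γ x y z w ≈ bilinear α β′ β γ z w x y
  bilinear-transpose = solve 8 (λ α β β′ γ x y z w →
    :bilinear α β β′ γ x y z w := :bilinear α β′ β γ z w x y) refl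

  -- Change of basis: the four inner values are the Gram matrix in the basis (x, y), (z, w), with
  -- primes marking the conjugate basis.
  bilinear-basis : ∀ α β β′ γ x x′ y y′ z z′ w w′ X X′ Y Y′ →
    bilinear (bilinear α β β′ γ x′ y′ x y) (bilinear α β β′ γ x′ y′ z w)
             (bilinear α β β′ γ z′ w′ x y) (bilinear α β β′ γ z′ w′ z w) X′ Y′ X Y
    ≈ bilinear α β β′ γ (x′ * X′ + z′ * Y′) (y′ * X′ + w′ * Y′) (x * X + z * Y) (y * X + w * Y)
  bilinear-basis = solve 16 (λ α β β′ γ x x′ y y′ z z′ w w′ X X′ Y Y′ →
    :bilinear (:bilinear α β β′ γ x′ y′ x y) (:bilinear α β β′ γ x′ y′ z w)
              (:bilinear α β β′ γ z′ w′ x y) (:bilinear α β β′ γ z′ w′ z w) X′ Y′ X Y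
    := :bilinear α β β′ γ (x′ :* X′ :+ z′ :* Y′) (y′ :* X′ :+ w′ :* Y′) (x :* X :+ z :* Y) (y :* X :+ w :* Y)) refl

  -- The polarisation of minus the determinant.
  polar₄ : (α₁ β₁ β₁′ γ₁ α₂ β₂ β₂′ γ₂ : Carrier) → Carrier
  polar₄ α₁ β₁ β₁′ γ₁ α₂ β₂ β₂′ γ₂ = β₁ * β₂′ + β₁′ * β₂ - α₁ * γ₂ - α₂ * γ₁

  -- Obtained by polarising the multiplicativity of the determinant, which is `disc₄-basis`; the
  -- factor is the determinant of the basis times that of the conjugate basis.
  polar₄-basis : ∀ x x′ y y′ z z′ w w′ α₁ β₁ β₁′ γ₁ α₂ β₂ β₂′ γ₂ →
    polar₄ (bilinear α₁ β₁ β₁′ γ₁ x′ y′ x y) (bilinear α₁ β₁ β₁′ γ₁ x′ y′ z w)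
           (bilinear α₁ β₁ β₁′ γ₁ z′ w′ x y) (bilinear α₁ β₁ β₁′ γ₁ z′ w′ z w)
           (bilinear α₂ β₂ β₂′ γ₂ x′ y′ x y) (bilinear α₂ β₂ β₂′ γ₂ x′ y′ z w)
           (bilinear α₂ β₂ β₂′ γ₂ z′ w′ x y) (bilinear α₂ β₂ β₂′ γ₂ z′ w′ z w)
    ≈ ((x * w - z * y) * (x′ * w′ - z′ * y′)) * polar₄ α₁ β₁ β₁′ γ₁ α₂ β₂ β₂′ γ₂
  polar₄-basis = solve 16 (λ x x′ y y′ z z′ w w′ α₁ β₁ β₁′ γ₁ α₂ β₂ β₂′ γ₂ →
    :polar₄ (:bilinear α₁ β₁ β₁′ γ₁ x′ y′ x y) (:bilinear α₁ β₁ β₁′ γ₁ x′ y′ z w)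
            (:bilinear α₁ β₁ β₁′ γ₁ z′ w′ x y) (:bilinear α₁ β₁ β₁′ γ₁ z′ w′ z w)
            (:bilinear α₂ β₂ β₂′ γ₂ x′ y′ x y) (:bilinear α₂ β₂ β₂′ γ₂ x′ y′ z w)
            (:bilinear α₂ β₂ β₂′ γ₂ z′ w′ x y) (:bilinear α₂ β₂ β₂′ γ₂ z′ w′ z w)
    := ((x :* w :- z :* y) :* (x′ :* w′ :- z′ :* y′)) :* :polar₄ α₁ β₁ β₁′ γ₁ α₂ β₂ β₂′ γ₂) refl
    where :polar₄ = λ {n} α₁ β₁ β₁′ γ₁ α₂ β₂ β₂′ γ₂ → _:-_ {n} (β₁ :* β₂′ :+ β₁′ :* β₂ :- α₁ :* γ₂) (α₂ :* γ₁)

  disc₄-basis : ∀ x x′ y y′ z z′ w w′ α β β′ γ →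
    bilinear α β β′ γ x′ y′ z w * bilinear α β β′ γ z′ w′ x y
      - bilinear α β β′ γ x′ y′ x y * bilinear α β β′ γ z′ w′ z w
    ≈ ((x * w - z * y) * (x′ * w′ - z′ * y′)) * (β * β′ - α * γ)
  disc₄-basis = solve 12 (λ x x′ y y′ z z′ w w′ α β β′ γ →
    :bilinear α β β′ γ x′ y′ z w :* :bilinear α β β′ γ z′ w′ x y
      :- :bilinear α β β′ γ x′ y′ x y :* :bilinear α β β′ γ z′ w′ z w
    := ((x :* w :- z :* y) :* (x′ :* w′ :- z′ :* y′)) :* (β :* β′ :- α :* γ)) refl

-- Conjugation and the subfield GF(q)

module CapacitanceInvariance {a₁ ℓ₁ a₂ ℓ₂} {p m : ℕ} (p-prime : Prime p) (p≢2 : p ≢ 2) (1≤m : 1 ℕ.≤ m)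
  (E : QuadraticExtension (p ℕ.^ m) a₁ ℓ₁ a₂ ℓ₂) where

  open MöbiusPlane E
  open K hiding (zero)
  open FieldProperties GF[q²]
  open Algebra.Properties.CommutativeSemiring.Exp commutativeSemiring
  open Algebra.Properties.Semiring.Mult semiring using (×1-homo-*; ×-congˡ) renaming (_×_ to _·_)
  open Algebra.Properties.Group +-group using (inverseʳ-unique; identityʳ-unique; x∙y⁻¹≈ε⇒x≈y; x≈y⇒x∙y⁻¹≈ε)
  open IntegerRingSolver commutativeRing
  open BilinearIdentities commutativeRing
  open RingMorphisms.IsRingHomomorphism isRingHomomorphism
  module FE = Algebra.Properties.CommutativeSemiring.Exp F.commutativeSemiring
  open Relation.Binary.Reasoning.Setoid setoid

  q : ℕ
  q = p ℕ.^ m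

  2≤q : 2 ℕ.≤ q
  2≤q = 2≤p^m p-prime 1≤m

  open FiniteField GF[q²] GF[q²]-order using (characteristic)
  open SquareOrder GF[q²] 2≤q GF[q²]-order
  private module FF = FiniteField GF[q] GF[q]-order

  p·1≈0 : p · 1# ≈ 0#
  p·1≈0 = characteristic p (m ℕ.* 2) (ℕ.^-*-assoc p m 2)

  open Frobenius commutativeRing

  -- Writing p = 1 + 2j, vanishing of 2 would make p · 1 equal to 1, but it is 0.
  2≉0 : 1# + 1# ≉ 0#
  2≉0 2≈0 with j , p≡1+2j ← odd-prime⇒≡1+2j p-prime p≢2 = 0≉1 (begin
    0#                     ≈⟨ p·1≈0 ⟨
    p · 1#                 ≈⟨ ×-congˡ p≡1+2j ⟩
    1# + (j ℕ.* 2) · 1#    ≈⟨ +-congˡ (×1-homo-* j 2) ⟩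
    1# + j · 1# * (2 · 1#) ≈⟨ +-congˡ (*-congˡ (trans (+-congˡ (+-identityʳ 1#)) 2≈0)) ⟩
    1# + j · 1# * 0#       ≈⟨ +-congˡ (zeroʳ _) ⟩
    1# + 0#                ≈⟨ +-identityʳ 1# ⟩
    1#                     ∎)

  bar-cong : ∀ {x y} → x ≈ y → bar x ≈ bar y
  bar-cong = ^-congˡ q

  bar-+ : ∀ x y → bar (x + y) ≈ bar x + bar y
  bar-+ = ^p^m-+ p-prime p·1≈0 m

  bar-* : ∀ x y → bar (x * y) ≈ bar x * bar y
  bar-* x y = ^-distrib-* x y q

  bar-involutive : ∀ x → bar (bar x) ≈ x
  bar-involutive = ^q-involutive

  bar-0 : bar 0# ≈ 0#
  bar-0 = go q 2≤q
    where
    go : ∀ n → 2 ℕ.≤ n → 0# ^ n ≈ 0#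
    go (suc n) _ = zeroˡ _

  bar-1 : bar 1# ≈ 1#
  bar-1 = go q
    where
    go : ∀ n → 1# ^ n ≈ 1#
    go zero    = refl
    go (suc n) = trans (*-identityˡ _) (go n)

  bar-neg : ∀ x → bar (- x) ≈ - bar x
  bar-neg x = inverseʳ-unique (bar x) (bar (- x)) (begin
    bar x + bar (- x)  ≈⟨ bar-+ x (- x) ⟨
    bar (x - x)        ≈⟨ bar-cong (-‿inverseʳ x) ⟩
    bar 0#             ≈⟨ bar-0 ⟩
    0#                 ∎)

  bar-nonZero : ∀ {x} → x ≉ 0# → bar x ≉ 0#
  bar-nonZero x≉0 barx≈0 = x≉0 (trans (sym (bar-involutive _)) (trans (bar-cong barx≈0) bar-0))

  bar-ι : ∀ c → bar (ι c) ≈ ι c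
  bar-ι c = trans (sym (ι-^ q)) (⟦⟧-cong (FF.x^n≈x c))
    where
    ι-^ : ∀ n → ι (c FE.^ n) ≈ ι c ^ n
    ι-^ zero    = 1#-homo
    ι-^ (suc n) = trans (*-homo c _) (*-congˡ (ι-^ n))

  ι-nonZero : ∀ {c} → c F.≉ F.0# → ι c ≉ 0#
  ι-nonZero {c} c≉0 ιc≈0 = 0≉1 (begin
    0#                ≈⟨ zeroˡ _ ⟨
    0# * ι (c F.⁻¹)   ≈⟨ *-congʳ ιc≈0 ⟨
    ι c * ι (c F.⁻¹)  ≈⟨ *-homo c (c F.⁻¹) ⟨
    ι (c F.* c F.⁻¹)  ≈⟨ ⟦⟧-cong (F.inverseʳ c c≉0) ⟩
    ι F.1#            ≈⟨ 1#-homo ⟩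
    1#                ∎)

  ι-≉ : ∀ {c d} → c F.≉ d → ι c ≉ ι d
  ι-≉ {c} {d} c≉d ιc≈ιd = ι-nonZero (FieldProperties.x≉y⇒x-y≉0 GF[q] c≉d) (begin
    ι (c F.- d)      ≈⟨ +-homo c (F.- d) ⟩
    ι c + ι (F.- d)  ≈⟨ +-congˡ (-‿homo d) ⟩
    ι c - ι d        ≈⟨ +-congʳ ιc≈ιd ⟩
    ι d - ι d        ≈⟨ -‿inverseʳ (ι d) ⟩
    0#               ∎)

  -- x^q - x already has its q roots in GF(q).
  fixed⇒∈GF[q] : ∀ {z} → bar z ≈ z → ∃ λ c → ι c ≈ z
  fixed⇒∈GF[q] {z} bar-z≈z with Fin.any? (λ i → ι (FF.element i) ≟ z)
  ... | yes (i , ι≈z) = FF.element i , ι≈z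
  ... | no  ¬ι≈z      = contradiction fixed (x^n≈x-¬tooManyRoots 2≤q roots distinct)
    where
    open RootCounting GF[q²]
    roots : Fin (suc q) → Carrier
    roots zero    = z
    roots (suc i) = ι (FF.element i)
    distinct : Distinct roots
    distinct zero    zero    i≢j = contradiction ≡.refl i≢j
    distinct zero    (suc j) i≢j = λ z≈ι → ¬ι≈z (j , sym z≈ι)
    distinct (suc i) zero    i≢j = λ ι≈z → ¬ι≈z (i , ι≈z)
    distinct (suc i) (suc j) i≢j = ι-≉ (FF.element-distinct i j (i≢j ∘ ≡.cong suc))
    fixed : ∀ i → roots i ^ q ≈ roots i
    fixed zero    = bar-z≈z
    fixed (suc i) = bar-ι (FF.element i)

  -- Conjugation negates `w - bar w`, which is nonzero as soon as `w` is not fixed. Such an element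
  -- gives the direction of a line in `B²-⊆`.
  ∃-antifixed : ∃ λ ω → ω ≉ 0# × bar ω ≈ - ω
  ∃-antifixed with w , bar-w≉w ← ∃-nonFixed = w - bar w , x≉y⇒x-y≉0 (bar-w≉w ∘ sym) , (begin
    bar (w - bar w)          ≈⟨ bar-+ w (- bar w) ⟩
    bar w + bar (- bar w)    ≈⟨ +-congˡ (bar-neg (bar w)) ⟩
    bar w - bar (bar w)      ≈⟨ +-congˡ (-‿cong (bar-involutive w)) ⟩
    bar w - w                ≈⟨ solve 2 (λ w w̄ → w̄ :- w := :- (w :- w̄)) refl w (bar w) ⟩
    - (w - bar w)            ∎)

  -- Hermitian forms and their zero sets

  -- The Hermitian form α x x̄ + β̄ x ȳ + β x̄ y + γ y ȳ.
  record Form : Set (a₂ ⊔ ℓ₂) where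
    field
      α β γ : Carrier
      bar-α : bar α ≈ α
      bar-γ : bar γ ≈ γ
      disc≉0 : β * bar β - α * γ ≉ 0#

    disc : Carrier
    disc = β * bar β - α * γ

    sesq : (x y z w : Carrier) → Carrier
    sesq x y z w = bilinear α β (bar β) γ (bar x) (bar y) z w

  open Form

  polar : Form → Form → Carrier
  polar H₁ H₂ = polar₄ (α H₁) (β H₁) (bar (β H₁)) (γ H₁) (α H₂) (β H₂) (bar (β H₂)) (γ H₂)

  num den : Point → Carrier
  num (fin z) = z
  num ∞       = 1#
  den (fin z) = 1#
  den ∞       = 0#

  num-den-≉0 : ∀ P → ¬ (num P ≈ 0# × den P ≈ 0#)
  num-den-≉0 (fin z) (_ , 1≈0) = 0≉1 (sym 1≈0)
  num-den-≉0 ∞       (1≈0 , _) = 0≉1 (sym 1≈0)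

  ⟪_⟫ : Form → Pred Point ℓ₂
  ⟪ H ⟫ P = sesq H (num P) (den P) (num P) (den P) ≈ 0#

  sesq-cong : ∀ H {x x′ y y′ z z′ w w′} → x ≈ x′ → y ≈ y′ → z ≈ z′ → w ≈ w′ →
    sesq H x y z w ≈ sesq H x′ y′ z′ w′
  sesq-cong H x y z w = bilinear-cong (α H) (β H) (bar (β H)) (γ H) (bar-cong x) (bar-cong y) z w

  -- The matrix of the form equals its conjugate transpose. On equal arguments this puts the value
  -- in the fixed field, which supplies `bar-α` and `bar-γ` for a transformed form.
  bar-sesq : ∀ H x y z w → bar (sesq H x y z w) ≈ sesq H z w x y
  bar-sesq H x y z w = begin
    bar (sesq H x y z w)
      ≈⟨ bar-+ _ _ ⟩
    bar (bar x * (α H * z + β H * w)) + bar (bar y * (bar (β H) * z + γ H * w))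
      ≈⟨ +-cong (bar-row x (bar-α H) refl) (bar-row y (bar-involutive (β H)) (bar-γ H)) ⟩
    bilinear (α H) (bar (β H)) (β H) (γ H) x y (bar z) (bar w)
      ≈⟨ bilinear-transpose _ _ _ _ x y (bar z) (bar w) ⟩
    sesq H z w x y ∎
    where
    bar-row : ∀ x {s s′ t t′} → bar s ≈ s′ → bar t ≈ t′ →
      bar (bar x * (s * z + t * w)) ≈ x * (s′ * bar z + t′ * bar w)
    bar-row x {s} {s′} {t} {t′} s̄≈ t̄≈ = begin
      bar (bar x * (s * z + t * w))         ≈⟨ bar-* _ _ ⟩
      bar (bar x) * bar (s * z + t * w)     ≈⟨ *-cong (bar-involutive x) (bar-+ _ _) ⟩
      x * (bar (s * z) + bar (t * w))       ≈⟨ *-congˡ (+-cong (bar-* s z) (bar-* t w)) ⟩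
      x * (bar s * bar z + bar t * bar w)   ≈⟨ *-congˡ (+-cong (*-congʳ s̄≈) (*-congʳ t̄≈)) ⟩
      x * (s′ * bar z + t′ * bar w)         ∎

  sesq-scale : ∀ H t x y → sesq H (t * x) (t * y) (t * x) (t * y) ≈ (t * bar t) * sesq H x y x y
  sesq-scale H t x y = trans
    (bilinear-cong (α H) (β H) (bar (β H)) (γ H) (bar-* t x) (bar-* t y) refl refl)
    (bilinear-scale (α H) (β H) (bar (β H)) (γ H) (bar t) t (bar x) (bar y) x y)

  norm-nonZero : ∀ {x} → x ≉ 0# → x * bar x ≉ 0#
  norm-nonZero x≉0 = *-nonZero x≉0 (bar-nonZero x≉0)

  -- Homogeneous coordinates

  infix 4 _∶_∼_

  record _∶_∼_ (x y : Carrier) (P : Point) : Set (a₂ ⊔ ℓ₂) where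
    constructor proportional
    field
      factor   : Carrier
      factor≉0 : factor ≉ 0#
      x≈       : x ≈ factor * num P
      y≈       : y ≈ factor * den P

  ∼-congˡ : ∀ {x x′ y y′ P} → x ≈ x′ → y ≈ y′ → x ∶ y ∼ P → x′ ∶ y′ ∼ P
  ∼-congˡ x≈x′ y≈y′ (proportional t t≉0 x≈ y≈) =
    proportional t t≉0 (trans (sym x≈x′) x≈) (trans (sym y≈y′) y≈)

  ÷-zero : ∀ x {y} → y ≈ 0# → x ÷ y ≡ ∞
  ÷-zero x {y} y≈0 = ≡.cong (if_then ∞ else fin (x * y ⁻¹)) (dec-true (y ≟ 0#) y≈0)

  ÷-nonZero : ∀ x {y} → y ≉ 0# → x ÷ y ≡ fin (x * y ⁻¹)
  ÷-nonZero x {y} y≉0 = ≡.cong (if_then ∞ else fin (x * y ⁻¹)) (dec-false (y ≟ 0#) y≉0)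

  ÷-∼ : ∀ x y → ¬ (x ≈ 0# × y ≈ 0#) → x ∶ y ∼ (x ÷ y)
  ÷-∼ x y xy≉0 with y ≟ 0#
  ... | yes y≈0 = ≡.subst (x ∶ y ∼_) (≡.sym (÷-zero x y≈0))
    (proportional x (λ x≈0 → xy≉0 (x≈0 , y≈0)) (sym (*-identityʳ x)) (trans y≈0 (sym (zeroʳ x))))
  ... | no  y≉0 = ≡.subst (x ∶ y ∼_) (≡.sym (÷-nonZero x y≉0))
    (proportional y y≉0 (begin
      x               ≈⟨ *-identityˡ x ⟨
      1# * x          ≈⟨ *-congʳ (inverseʳ y y≉0) ⟨
      y * y ⁻¹ * x    ≈⟨ solve 3 (λ x y i → y :* i :* x := y :* (x :* i)) refl x y (y ⁻¹) ⟩
      y * (x * y ⁻¹)  ∎) (sym (*-identityʳ y)))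

  proportional⇒≈ₚ : ∀ P Q {s t} → s ≉ 0# → t ≉ 0# → s * num P ≈ t * num Q → s * den P ≈ t * den Q → P ≈ₚ Q
  proportional⇒≈ₚ (fin z) (fin w) {s} {t} s≉0 _ sz≈tw s≈t = fin (*-cancelˡ-nonZero s s≉0
    (trans sz≈tw (*-congʳ (trans (sym (*-identityʳ t)) (trans (sym s≈t) (*-identityʳ s))))))
  proportional⇒≈ₚ (fin z) ∞ {s} {t} s≉0 _ _ s≈0 =
    contradiction (trans (sym (*-identityʳ s)) (trans s≈0 (zeroʳ t))) s≉0
  proportional⇒≈ₚ ∞ (fin w) {s} {t} _ t≉0 _ 0≈t =
    contradiction (trans (sym (*-identityʳ t)) (trans (sym 0≈t) (zeroʳ s))) t≉0
  proportional⇒≈ₚ ∞ ∞ _ _ _ _ = ∞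

  ∈-homogeneous : ∀ H {x y P} → x ∶ y ∼ P → sesq H x y x y ≈ 0# → ⟪ H ⟫ P
  ∈-homogeneous H {x} {y} {P} (proportional t t≉0 x≈ y≈) sesq≈0 =
    xy≈0⇒y≈0 (t * bar t) (norm-nonZero t≉0) (begin
      (t * bar t) * sesq H (num P) (den P) (num P) (den P)         ≈⟨ sesq-scale H t (num P) (den P) ⟨
      sesq H (t * num P) (t * den P) (t * num P) (t * den P)       ≈⟨ sesq-cong H x≈ y≈ x≈ y≈ ⟨
      sesq H x y x y                                               ≈⟨ sesq≈0 ⟩
      0#                                                           ∎)

  ⟪⟫-respects-≈ₚ : ∀ H {P Q} → P ≈ₚ Q → ⟪ H ⟫ P → ⟪ H ⟫ Q
  ⟪⟫-respects-≈ₚ H (fin z≈w) = trans (sesq-cong H (sym z≈w) refl (sym z≈w) refl)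
  ⟪⟫-respects-≈ₚ H ∞         = λ ∈ → ∈

  -- The action of Möbius transformations on forms

  module _ (τ : MöbiusTransformation) where
    open MöbiusTransformation τ hiding (apply)

    det : Carrier
    det = a * d - b * c

    -- Cramer's rule. It ensures that numerator and denominator in `apply` never vanish together.
    singular⇒0 : ∀ {x y} → a * x + b * y ≈ 0# → c * x + d * y ≈ 0# → x ≈ 0# × y ≈ 0#
    singular⇒0 {x} {y} top≈0 bottom≈0 =
      xy≈0⇒y≈0 det ad-bc≉0 (begin
        det * x                                      ≈⟨ solve 6 (λ a b c d x y → (a :* d :- b :* c) :* x := d :* (a :* x :+ b :* y) :- b :* (c :* x :+ d :* y)) refl a b c d x y ⟩
        d * (a * x + b * y) - b * (c * x + d * y)    ≈⟨ vanish d b top≈0 bottom≈0 ⟩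
        0#                                           ∎) ,
      xy≈0⇒y≈0 det ad-bc≉0 (begin
        det * y                                      ≈⟨ solve 6 (λ a b c d x y → (a :* d :- b :* c) :* y := a :* (c :* x :+ d :* y) :- c :* (a :* x :+ b :* y)) refl a b c d x y ⟩
        a * (c * x + d * y) - c * (a * x + b * y)    ≈⟨ vanish a c bottom≈0 top≈0 ⟩
        0#                                           ∎)
      where
      vanish : ∀ s t {u v} → u ≈ 0# → v ≈ 0# → s * u - t * v ≈ 0#
      vanish s t u≈0 v≈0 = trans (+-cong (*-congˡ u≈0) (-‿cong (*-congˡ v≈0)))
        (solve 2 (λ s t → s :* con (+ 0) :- t :* con (+ 0) := con (+ 0)) refl s t)

    -- In homogeneous coordinates `apply` is the linear map of the matrix, so later arguments need
    -- not distinguish whether a point or its image is `∞`.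
    apply-∼ : ∀ P → (a * num P + b * den P) ∶ (c * num P + d * den P) ∼ apply τ P
    apply-∼ P@(fin z) = ∼-congˡ (sym top) (sym bottom) (÷-∼ (a * z + b) (c * z + d)
      (λ (t≈0 , b≈0) → num-den-≉0 P (singular⇒0 (trans top t≈0) (trans bottom b≈0))))
      where
      top    = +-congˡ (*-identityʳ b)
      bottom = +-congˡ (*-identityʳ d)
    apply-∼ ∞ = ∼-congˡ (sym top) (sym bottom) (÷-∼ a c
      (λ (t≈0 , b≈0) → num-den-≉0 ∞ (singular⇒0 (trans top t≈0) (trans bottom b≈0))))
      where
      top : a * 1# + b * 0# ≈ a
      top = solve 2 (λ a b → a :* con (+ 1) :+ b :* con (+ 0) := a) refl a b
      bottom : c * 1# + d * 0# ≈ c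
      bottom = solve 2 (λ a b → a :* con (+ 1) :+ b :* con (+ 0) := a) refl c d

    norm-det : (d * a - (- b) * (- c)) * (bar d * bar a - bar (- b) * bar (- c)) ≈ det * bar det
    norm-det = *-cong (lemma a b c d) (begin
      bar d * bar a - bar (- b) * bar (- c)   ≈⟨ +-congˡ (-‿cong (*-cong (bar-neg b) (bar-neg c))) ⟩
      bar d * bar a - (- bar b) * (- bar c)   ≈⟨ lemma (bar a) (bar b) (bar c) (bar d) ⟩
      bar a * bar d - bar b * bar c           ≈⟨ +-cong (bar-* a d) (-‿cong (bar-* b c)) ⟨
      bar (a * d) - bar (b * c)               ≈⟨ +-congˡ (bar-neg (b * c)) ⟨
      bar (a * d) + bar (- (b * c))           ≈⟨ bar-+ _ _ ⟨
      bar det                                 ∎)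
      where
      lemma : ∀ a b c d → d * a - (- b) * (- c) ≈ a * d - b * c
      lemma = solve 4 (λ a b c d → d :* a :- (:- b) :* (:- c) := a :* d :- b :* c) refl

    sesq-disc : ∀ H → sesq H d (- c) (- b) a * bar (sesq H d (- c) (- b) a)
      - sesq H d (- c) d (- c) * sesq H (- b) a (- b) a ≈ (det * bar det) * disc H
    sesq-disc H = trans (+-congʳ (*-congˡ (bar-sesq H d (- c) (- b) a)))
      (trans (disc₄-basis d (bar d) (- c) (bar (- c)) (- b) (bar (- b)) a (bar a) (α H) (β H) (bar (β H)) (γ H))
             (*-congʳ norm-det))

    -- The form v ↦ H (adj τ · v), with adj τ = (d −b ; −c a).
    transform : Form → Form
    transform H = record
      { α      = sesq H d (- c) d (- c)
      ; β      = sesq H d (- c) (- b) a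
      ; γ      = sesq H (- b) a (- b) a
      ; bar-α  = bar-sesq H d (- c) d (- c)
      ; bar-γ  = bar-sesq H (- b) a (- b) a
      ; disc≉0 = λ disc≈0 → *-nonZero (norm-nonZero ad-bc≉0) (disc≉0 H) (trans (sym (sesq-disc H)) disc≈0)
      }

    transform-disc : ∀ H → disc (transform H) ≈ (det * bar det) * disc H
    transform-disc = sesq-disc

    transform-polar : ∀ H₁ H₂ → polar (transform H₁) (transform H₂) ≈ (det * bar det) * polar H₁ H₂
    transform-polar H₁ H₂ = trans
      (+-congʳ (+-congʳ (+-cong (*-congˡ (bar-sesq H₂ d (- c) (- b) a)) (*-congʳ (bar-sesq H₁ d (- c) (- b) a)))))
      (trans (polar₄-basis d (bar d) (- c) (bar (- c)) (- b) (bar (- b)) a (bar a)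
               (α H₁) (β H₁) (bar (β H₁)) (γ H₁) (α H₂) (β H₂) (bar (β H₂)) (γ H₂))
             (*-congʳ norm-det))

    transform-sesq : ∀ H x y → let u = d * x + (- b) * y ; v = (- c) * x + a * y in
      sesq (transform H) x y x y ≈ sesq H u v u v
    transform-sesq H x y = begin
      sesq (transform H) x y x y
        ≈⟨ bilinear-congᶜ (bar x) (bar y) x y refl refl (bar-sesq H d (- c) (- b) a) refl ⟩
      bilinear (sesq H d (- c) d (- c)) (sesq H d (- c) (- b) a)
               (sesq H (- b) a d (- c)) (sesq H (- b) a (- b) a) (bar x) (bar y) x y
        ≈⟨ bilinear-basis (α H) (β H) (bar (β H)) (γ H) d (bar d) (- c) (bar (- c)) (- b) (bar (- b)) a (bar a) x (bar x) y (bar y) ⟩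
      bilinear (α H) (β H) (bar (β H)) (γ H) (bar d * bar x + bar (- b) * bar y) (bar (- c) * bar x + bar a * bar y)
               (d * x + (- b) * y) ((- c) * x + a * y)
        ≈⟨ bilinear-cong (α H) (β H) (bar (β H)) (γ H) (bar-row d (- b)) (bar-row (- c) a) refl refl ⟨
      sesq H (d * x + (- b) * y) ((- c) * x + a * y) (d * x + (- b) * y) ((- c) * x + a * y) ∎
      where
      bar-row : ∀ s t → bar (s * x + t * y) ≈ bar s * bar x + bar t * bar y
      bar-row s t = trans (bar-+ _ _) (+-cong (bar-* s x) (bar-* t y))

  -- The adjugate differs from the inverse matrix by a scalar, which does not affect the action on
  -- points.
  inverse : MöbiusTransformation → MöbiusTransformation
  inverse τ = record
    { a = d ; b = - b ; c = - c ; d = a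
    ; ad-bc≉0 = ad-bc≉0 ∘ trans (solve 4 (λ a b c d → a :* d :- b :* c := d :* a :- (:- b) :* (:- c)) refl a b c d)
    }
    where open MöbiusTransformation τ

  -- The adjugate times the matrix of `τ` is `D` times the identity, so the transformed form at the
  -- image of `P` is the norm of `D` times the value of `H` at `P`, up to the choice of homogeneous
  -- coordinates.
  transform-image : ∀ τ H → ⟪ transform τ H ⟫ ≐ image τ ⟪ H ⟫
  transform-image τ H = forward , backward
    where
    open MöbiusTransformation τ hiding (apply)

    D = det τ

    adj-top : ∀ x y → d * (a * x + b * y) + (- b) * (c * x + d * y) ≈ D * x
    adj-top = solve 6 (λ a b c d x y → d :* (a :* x :+ b :* y) :+ (:- b) :* (c :* x :+ d :* y) := (a :* d :- b :* c) :* x) refl a b c d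

    adj-bottom : ∀ x y → (- c) * (a * x + b * y) + a * (c * x + d * y) ≈ D * y
    adj-bottom = solve 6 (λ a b c d x y → (:- c) :* (a :* x :+ b :* y) :+ a :* (c :* x :+ d :* y) := (a :* d :- b :* c) :* y) refl a b c d

    backward : ∀ {Q} → image τ ⟪ H ⟫ Q → ⟪ transform τ H ⟫ Q
    backward {Q} (P , P∈H , τP≈Q) = ⟪⟫-respects-≈ₚ (transform τ H) τP≈Q (∈-homogeneous (transform τ H) (apply-∼ τ P) (begin
      sesq (transform τ H) u v u v                              ≈⟨ transform-sesq τ H u v ⟩
      sesq H _ _ _ _                                          ≈⟨ sesq-cong H top bottom top bottom ⟩
      sesq H (D * num P) (D * den P) (D * num P) (D * den P) ≈⟨ sesq-scale H D (num P) (den P) ⟩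
      (D * bar D) * sesq H (num P) (den P) (num P) (den P) ≈⟨ *-congˡ P∈H ⟩
      (D * bar D) * 0#                                    ≈⟨ zeroʳ _ ⟩
      0#                                                      ∎))
      where
      u = a * num P + b * den P
      v = c * num P + d * den P
      top    = adj-top (num P) (den P)
      bottom = adj-bottom (num P) (den P)

    forward : ∀ {Q} → ⟪ transform τ H ⟫ Q → image τ ⟪ H ⟫ Q
    forward {Q} Q∈ = P , ∈-homogeneous H P∼ (trans (sym (transform-sesq τ H (num Q) (den Q))) Q∈) ,
      -- Applying `inverse τ` and then `τ` introduces the factors `t` and `s`; the matrix product
      -- gives `D` on the side of `Q`.
      proportional⇒≈ₚ (apply τ P) Q (*-nonZero t≉0 s≉0) ad-bc≉0
        (begin
          t * s * num (apply τ P)                    ≈⟨ *-assoc _ _ _ ⟩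
          t * (s * num (apply τ P))                  ≈⟨ *-congˡ Mx≈ ⟨
          t * (a * num P + b * den P)                ≈⟨ scale-row a b ⟩
          a * (t * num P) + b * (t * den P)          ≈⟨ +-cong (*-congˡ x≈) (*-congˡ y≈) ⟨
          a * (d * num Q + (- b) * den Q) + b * ((- c) * num Q + a * den Q)
            ≈⟨ solve 6 (λ a b c d x y → a :* (d :* x :+ (:- b) :* y) :+ b :* ((:- c) :* x :+ a :* y) := (a :* d :- b :* c) :* x) refl a b c d (num Q) (den Q) ⟩
          D * num Q                                ∎)
        (begin
          t * s * den (apply τ P)                    ≈⟨ *-assoc _ _ _ ⟩
          t * (s * den (apply τ P))                  ≈⟨ *-congˡ My≈ ⟨
          t * (c * num P + d * den P)                ≈⟨ scale-row c d ⟩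
          c * (t * num P) + d * (t * den P)          ≈⟨ +-cong (*-congˡ x≈) (*-congˡ y≈) ⟨
          c * (d * num Q + (- b) * den Q) + d * ((- c) * num Q + a * den Q)
            ≈⟨ solve 6 (λ a b c d x y → c :* (d :* x :+ (:- b) :* y) :+ d :* ((:- c) :* x :+ a :* y) := (a :* d :- b :* c) :* y) refl a b c d (num Q) (den Q) ⟩
          D * den Q                                ∎)
      where
      P = apply (inverse τ) Q
      P∼ = apply-∼ (inverse τ) Q
      open _∶_∼_ P∼ renaming (factor to t; factor≉0 to t≉0)
      open _∶_∼_ (apply-∼ τ P) renaming (factor to s; factor≉0 to s≉0; x≈ to Mx≈; y≈ to My≈)
      scale-row : ∀ e f → t * (e * num P + f * den P) ≈ e * (t * num P) + f * (t * den P)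
      scale-row e f = solve 5 (λ t e f x y → t :* (e :* x :+ f :* y) := e :* (t :* x) :+ f :* (t :* y)) refl t e f (num P) (den P)

  -- The forms of circles

  bar-norm : ∀ x → bar (x * bar x) ≈ x * bar x
  bar-norm x = trans (bar-* x (bar x)) (trans (*-congˡ (bar-involutive x)) (*-comm _ _))

  bar-neg-ι : ∀ c → bar (- ι c) ≈ - ι c
  bar-neg-ι c = trans (bar-neg (ι c)) (-‿cong (bar-ι c))

  form-disc¹ : ∀ s c → (- s) * bar (- s) - 1# * (s * bar s - ι c) ≈ ι c
  form-disc¹ s c = trans (+-congʳ (*-congˡ (bar-neg s)))
    (solve 3 (λ s s̄ c → (:- s) :* (:- s̄) :- con (+ 1) :* (s :* s̄ :- c) := c) refl s (bar s) (ι c))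

  form-disc² : ∀ s c → s * bar s - 0# * (- ι c) ≈ s * bar s
  form-disc² s c = solve 2 (λ n c → n :- con (+ 0) :* (:- c) := n) refl (s * bar s) (ι c)

  -- The coefficients come from expanding the equation of the circle. This normalisation makes the
  -- discriminant c for the first type and the norm of s for the second, exactly the denominators
  -- occurring in `cap`.
  form : Circle → Form
  form (B¹ s c c≉0) = record
    { α = 1# ; β = - s ; γ = s * bar s - ι c
    ; bar-α = bar-1
    ; bar-γ = trans (bar-+ _ _) (+-cong (bar-norm s) (bar-neg-ι c))
    ; disc≉0 = ι-nonZero c≉0 ∘ trans (sym (form-disc¹ s c))
    }
  form (B² s c s≉0) = record
    { α = 0# ; β = s ; γ = - ι c
    ; bar-α = bar-0
    ; bar-γ = bar-neg-ι c
    ; disc≉0 = norm-nonZero s≉0 ∘ trans (sym (form-disc² s c))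
    }

  -- At `∞` the form takes the value α, which is 1 for the first type and 0 for the second.
  form-≐ : ∀ C → ⟪ form C ⟫ ≐ ⟦ C ⟧
  form-≐ (B¹ s c c≉0) = (λ {P} → to P) , (λ {P} → from P)
    where
    eval : ∀ z → bilinear 1# (- s) (bar (- s)) (s * bar s - ι c) (bar z) (bar 1#) z 1#
      ≈ (z - s) * (bar z - bar s) - ι c
    eval z = trans (bilinear-congᶜ _ _ _ _ refl refl (bar-neg s) refl)
      (trans (bilinear-cong _ _ _ _ refl bar-1 refl refl)
      (solve 5 (λ z z̄ s s̄ c →
         z̄ :* (con (+ 1) :* z :+ (:- s) :* con (+ 1)) :+ con (+ 1) :* ((:- s̄) :* z :+ (s :* s̄ :- c) :* con (+ 1))
         := (z :- s) :* (z̄ :- s̄) :- c) refl z (bar z) s (bar s) (ι c)))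
    eval-∞ : ¬ ⟪ form (B¹ s c c≉0) ⟫ ∞
    eval-∞ ≈0 = 0≉1 (trans (sym ≈0) (trans (bilinear-cong _ _ _ _ bar-1 bar-0 refl refl)
      (solve 3 (λ s s̄ γ → con (+ 1) :* (con (+ 1) :* con (+ 1) :+ (:- s) :* con (+ 0)) :+ con (+ 0) :* (s̄ :* con (+ 1) :+ γ :* con (+ 0)) := con (+ 1))
        refl s (bar (- s)) (s * bar s - ι c))))
    to : ∀ P → ⟪ form (B¹ s c c≉0) ⟫ P → ⟦ B¹ s c c≉0 ⟧ P
    to (fin z) ∈ = x∙y⁻¹≈ε⇒x≈y _ _ (trans (sym (eval z)) ∈)
    to ∞       ∈ = contradiction ∈ eval-∞
    from : ∀ P → ⟦ B¹ s c c≉0 ⟧ P → ⟪ form (B¹ s c c≉0) ⟫ P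
    from (fin z) ∈ = trans (eval z) (x≈y⇒x∙y⁻¹≈ε ∈)
  form-≐ (B² s c s≉0) = (λ {P} → to P) , (λ {P} → from P)
    where
    eval : ∀ z → bilinear 0# s (bar s) (- ι c) (bar z) (bar 1#) z 1# ≈ (bar s * z + s * bar z) - ι c
    eval z = trans (bilinear-cong _ _ _ _ refl bar-1 refl refl)
      (solve 5 (λ z z̄ s s̄ c →
         z̄ :* (con (+ 0) :* z :+ s :* con (+ 1)) :+ con (+ 1) :* (s̄ :* z :+ (:- c) :* con (+ 1))
         := (s̄ :* z :+ s :* z̄) :- c) refl z (bar z) s (bar s) (ι c))
    to : ∀ P → ⟪ form (B² s c s≉0) ⟫ P → ⟦ B² s c s≉0 ⟧ P
    to (fin z) ∈ = x∙y⁻¹≈ε⇒x≈y _ _ (trans (sym (eval z)) ∈)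
    to ∞       _ = _
    from : ∀ P → ⟦ B² s c s≉0 ⟧ P → ⟪ form (B² s c s≉0) ⟫ P
    from (fin z) ∈ = trans (eval z) (x≈y⇒x∙y⁻¹≈ε ∈)
    from ∞       _ = trans (bilinear-cong _ _ _ _ bar-1 bar-0 refl refl)
      (solve 3 (λ s s̄ γ → con (+ 1) :* (con (+ 0) :* con (+ 1) :+ s :* con (+ 0)) :+ con (+ 0) :* (s̄ :* con (+ 1) :+ γ :* con (+ 0)) := con (+ 0))
        refl s (bar s) (- ι c))

  -- Capacitance in terms of forms

  -- The common shape of the formulas for `cap`: `d` is a product of discriminants and `e` is the
  -- polar form up to sign. The factor `e * (e * 1#)` is the unfolded square.
  d⁻¹*e²*D≈P² : ∀ {d D e P} → D ≉ 0# → d ≈ D → e * e ≈ P * P →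
    d ⁻¹ * (e * (e * 1#)) * D ≈ P * P
  d⁻¹*e²*D≈P² {d} {D} {e} {P} D≉0 d≈D e²≈P² = begin
    d ⁻¹ * (e * (e * 1#)) * D   ≈⟨ *-congˡ d≈D ⟨
    d ⁻¹ * (e * (e * 1#)) * d   ≈⟨ solve 3 (λ d i e → i :* (e :* (e :* con (+ 1))) :* d := (d :* i) :* (e :* e)) refl d (d ⁻¹) e ⟩
    d * d ⁻¹ * (e * e)          ≈⟨ *-congʳ (inverseʳ d (D≉0 ∘ trans (sym d≈D))) ⟩
    1# * (e * e)                ≈⟨ *-identityˡ _ ⟩
    e * e                       ≈⟨ e²≈P² ⟩
    P * P                       ∎

  ≈⇒square≈ : ∀ {e P} → e ≈ P → e * e ≈ P * P
  ≈⇒square≈ e≈P = *-cong e≈P e≈P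

  ≈-⇒square≈ : ∀ {e P} → e ≈ - P → e * e ≈ P * P
  ≈-⇒square≈ {e} {P} e≈-P = trans (*-cong e≈-P e≈-P) (solve 1 (λ P → (:- P) :* (:- P) := P :* P) refl P)

  polar¹¹ : ∀ s₁ c₁ c₁≉0 s₂ c₂ c₂≉0 →
    ι c₁ + ι c₂ - (s₁ - s₂) * (bar s₁ - bar s₂) ≈ polar (form (B¹ s₁ c₁ c₁≉0)) (form (B¹ s₂ c₂ c₂≉0))
  polar¹¹ s₁ c₁ _ s₂ c₂ _ = trans
    (solve 6 (λ s s̄ t t̄ c d → c :+ d :- (s :- t) :* (s̄ :- t̄)
       := (:- s) :* (:- t̄) :+ (:- s̄) :* (:- t) :- con (+ 1) :* (t :* t̄ :- d) :- con (+ 1) :* (s :* s̄ :- c))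
      refl s₁ (bar s₁) s₂ (bar s₂) (ι c₁) (ι c₂))
    (+-congʳ (+-congʳ (+-cong (*-congˡ (sym (bar-neg s₂))) (*-congʳ (sym (bar-neg s₁))))))

  -- The sign arises because β is `- s` for the first type and `s` for the second; it disappears on
  -- squaring.
  polar¹² : ∀ s₁ c₁ c₁≉0 s₂ c₂ s₂≉0 →
    s₁ * bar s₂ + bar s₁ * s₂ - ι c₂ ≈ - polar (form (B¹ s₁ c₁ c₁≉0)) (form (B² s₂ c₂ s₂≉0))
  polar¹² s₁ c₁ _ s₂ c₂ _ = trans
    (solve 6 (λ s s̄ t t̄ d γ → s :* t̄ :+ s̄ :* t :- d
       := :- ((:- s) :* t̄ :+ (:- s̄) :* t :- con (+ 1) :* (:- d) :- con (+ 0) :* γ))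
      refl s₁ (bar s₁) s₂ (bar s₂) (ι c₂) (s₁ * bar s₁ - ι c₁))
    (-‿cong (+-congʳ (+-congʳ (+-congˡ (*-congʳ (sym (bar-neg s₁)))))))

  polar²² : ∀ s₁ c₁ s₁≉0 s₂ c₂ s₂≉0 →
    s₁ * bar s₂ + bar s₁ * s₂ ≈ polar (form (B² s₁ c₁ s₁≉0)) (form (B² s₂ c₂ s₂≉0))
  polar²² s₁ c₁ _ s₂ c₂ _ =
    solve 6 (λ s s̄ t t̄ c d → s :* t̄ :+ s̄ :* t
        := s :* t̄ :+ s̄ :* t :- con (+ 0) :* (:- d) :- con (+ 0) :* (:- c))
      refl s₁ (bar s₁) s₂ (bar s₂) (ι c₁) (ι c₂)

  polar-comm : ∀ H₁ H₂ → polar H₁ H₂ ≈ polar H₂ H₁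
  polar-comm H₁ H₂ =
    solve 8 (λ a b b̄ c a′ b′ b̄′ c′ → b :* b̄′ :+ b̄ :* b′ :- a :* c′ :- a′ :* c
        := b′ :* b̄ :+ b̄′ :* b :- a′ :* c :- a :* c′)
      refl (α H₁) (β H₁) (bar (β H₁)) (γ H₁) (α H₂) (β H₂) (bar (β H₂)) (γ H₂)

  cap-polar : ∀ C C̃ → cap C C̃ * (disc (form C) * disc (form C̃)) ≈ polar (form C) (form C̃) * polar (form C) (form C̃)
  cap-polar C@(B¹ s₁ c₁ c₁≉0) C̃@(B¹ s₂ c₂ c₂≉0) = d⁻¹*e²*D≈P²
    (*-nonZero (disc≉0 (form C)) (disc≉0 (form C̃)))
    (*-cong (sym (form-disc¹ s₁ c₁)) (sym (form-disc¹ s₂ c₂)))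
    (≈⇒square≈ (polar¹¹ s₁ c₁ c₁≉0 s₂ c₂ c₂≉0))
  cap-polar C@(B¹ s₁ c₁ c₁≉0) C̃@(B² s₂ c₂ s₂≉0) = d⁻¹*e²*D≈P²
    (*-nonZero (disc≉0 (form C)) (disc≉0 (form C̃)))
    (*-cong (sym (form-disc¹ s₁ c₁)) (sym (form-disc² s₂ c₂)))
    (≈-⇒square≈ (polar¹² s₁ c₁ c₁≉0 s₂ c₂ s₂≉0))
  cap-polar C@(B² s₂ c₂ s₂≉0) C̃@(B¹ s₁ c₁ c₁≉0) = begin
    cap C̃ C * (disc (form C) * disc (form C̃))                ≈⟨ *-congˡ (*-comm _ _) ⟩
    cap C̃ C * (disc (form C̃) * disc (form C))                ≈⟨ cap-polar C̃ C ⟩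
    polar (form C̃) (form C) * polar (form C̃) (form C)        ≈⟨ ≈⇒square≈ (polar-comm (form C̃) (form C)) ⟩
    polar (form C) (form C̃) * polar (form C) (form C̃)        ∎
  cap-polar C@(B² s₁ c₁ s₁≉0) C̃@(B² s₂ c₂ s₂≉0) = d⁻¹*e²*D≈P²
    (*-nonZero (disc≉0 (form C)) (disc≉0 (form C̃)))
    (*-cong (sym (form-disc² s₁ c₁)) (sym (form-disc² s₂ c₂)))
    (≈⇒square≈ (polar²² s₁ c₁ s₁≉0 s₂ c₂ s₂≉0))

  -- Proportional forms

  infix 4 _∝_

  -- The scalar has to be fixed by `bar` so that β and its conjugate scale alike. It is nonzero
  -- because the discriminant of `H` is.
  record _∝_ (H H′ : Form) : Set (a₂ ⊔ ℓ₂) where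
    field
      scalar     : Carrier
      bar-scalar : bar scalar ≈ scalar
      α≈ : α H ≈ scalar * α H′
      β≈ : β H ≈ scalar * β H′
      γ≈ : γ H ≈ scalar * γ H′

    bar-β≈ : bar (β H) ≈ scalar * bar (β H′)
    bar-β≈ = trans (bar-cong β≈) (trans (bar-* _ _) (*-congʳ bar-scalar))

    disc≈ : disc H ≈ (scalar * scalar) * disc H′
    disc≈ = trans (+-cong (*-cong β≈ bar-β≈) (-‿cong (*-cong α≈ γ≈)))
      (solve 5 (λ t a b b̄ c → (t :* b) :* (t :* b̄) :- (t :* a) :* (t :* c) := (t :* t) :* (b :* b̄ :- a :* c))
        refl scalar (α H′) (β H′) (bar (β H′)) (γ H′))

    scalar≉0 : scalar ≉ 0#
    scalar≉0 s≈0 = disc≉0 H (trans disc≈ (trans (*-congʳ (trans (*-congʳ s≈0) (zeroˡ _))) (zeroˡ _)))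

  ∝-trans : ∀ {H₁ H₂ H₃} → H₁ ∝ H₂ → H₂ ∝ H₃ → H₁ ∝ H₃
  ∝-trans p q = record
    { scalar     = P.scalar * Q.scalar
    ; bar-scalar = trans (bar-* _ _) (*-cong P.bar-scalar Q.bar-scalar)
    ; α≈ = compose P.α≈ Q.α≈
    ; β≈ = compose P.β≈ Q.β≈
    ; γ≈ = compose P.γ≈ Q.γ≈
    }
    where
    module P = _∝_ p
    module Q = _∝_ q
    compose : ∀ {x y z} → x ≈ P.scalar * y → y ≈ Q.scalar * z → x ≈ P.scalar * Q.scalar * z
    compose x≈ y≈ = trans x≈ (trans (*-congˡ y≈) (sym (*-assoc _ _ _)))

  ∝⇒≐ : ∀ {H H′} → H ∝ H′ → ⟪ H ⟫ ≐ ⟪ H′ ⟫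
  ∝⇒≐ {H} {H′} H∝H′ =
    (λ {P} ∈ → xy≈0⇒y≈0 scalar scalar≉0 (trans (sym (sesq≈ P)) ∈)) ,
    (λ {P} ∈ → trans (sesq≈ P) (trans (*-congˡ ∈) (zeroʳ _)))
    where
    open _∝_ H∝H′
    sesq≈ : ∀ P → sesq H (num P) (den P) (num P) (den P) ≈ scalar * sesq H′ (num P) (den P) (num P) (den P)
    sesq≈ P = trans (bilinear-congᶜ _ _ _ _ α≈ β≈ bar-β≈ γ≈) (bilinear-scaleᶜ scalar _ _ _ _ _ _ _ _)

  polar-∝ : ∀ {H₁ H₁′ H₂ H₂′} (p : H₁ ∝ H₁′) (q : H₂ ∝ H₂′) →
    polar H₁ H₂ ≈ (_∝_.scalar p * _∝_.scalar q) * polar H₁′ H₂′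
  polar-∝ {H₁} {H₁′} {H₂} {H₂′} p q = trans
    (+-cong (+-cong (+-cong (*-cong P.β≈ Q.bar-β≈) (*-cong P.bar-β≈ Q.β≈)) (-‿cong (*-cong P.α≈ Q.γ≈)))
            (-‿cong (*-cong Q.α≈ P.γ≈)))
    (solve 10 (λ s t a b b̄ c a′ b′ b̄′ c′ →
        (s :* b) :* (t :* b̄′) :+ (s :* b̄) :* (t :* b′) :- (s :* a) :* (t :* c′) :- (t :* a′) :* (s :* c)
        := (s :* t) :* (b :* b̄′ :+ b̄ :* b′ :- a :* c′ :- a′ :* c)) refl
      P.scalar Q.scalar (α H₁′) (β H₁′) (bar (β H₁′)) (γ H₁′) (α H₂′) (β H₂′) (bar (β H₂′)) (γ H₂′))
    where
    module P = _∝_ p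
    module Q = _∝_ q

  -- From forms back to circles

  bar-⁻¹ : ∀ {x} → x ≉ 0# → bar x ≈ x → bar (x ⁻¹) ≈ x ⁻¹
  bar-⁻¹ {x} x≉0 x̄≈x = *-cancelˡ-nonZero x x≉0 (begin
    x * bar (x ⁻¹)      ≈⟨ *-congʳ x̄≈x ⟨
    bar x * bar (x ⁻¹)  ≈⟨ bar-* _ _ ⟨
    bar (x * x ⁻¹)      ≈⟨ bar-cong (inverseʳ x x≉0) ⟩
    bar 1#              ≈⟨ bar-1 ⟩
    1#                  ≈⟨ inverseʳ x x≉0 ⟨
    x * x ⁻¹            ∎)

  ⁻¹-nonZero : ∀ {x} → x ≉ 0# → x ⁻¹ ≉ 0#
  ⁻¹-nonZero {x} x≉0 x⁻¹≈0 = 0≉1 (trans (sym (zeroʳ x)) (trans (*-congˡ (sym x⁻¹≈0)) (inverseʳ x x≉0)))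

  bar-disc : ∀ H → bar (disc H) ≈ disc H
  bar-disc H = begin
    bar (β H * bar (β H) - α H * γ H)              ≈⟨ bar-+ _ _ ⟩
    bar (β H * bar (β H)) + bar (- (α H * γ H))    ≈⟨ +-cong (bar-norm (β H)) (bar-neg _) ⟩
    β H * bar (β H) - bar (α H * γ H)              ≈⟨ +-congˡ (-‿cong (trans (bar-* _ _) (*-cong (bar-α H) (bar-γ H)))) ⟩
    disc H                                         ∎

  -- If α vanishes, the equation is that of a line with s = β and c = -γ. Otherwise, dividing by α
  -- and completing the square gives the centre -β/α and c = disc/α². Both values of c are fixed by
  -- `bar` and hence come from GF(q).
  toCircle : ∀ H → ∃ λ C → H ∝ form C
  toCircle H with α H ≟ 0#
  ... | yes α≈0 = B² (β H) c β≉0 , record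
    { scalar = 1# ; bar-scalar = bar-1
    ; α≈ = trans α≈0 (sym (zeroʳ 1#))
    ; β≈ = sym (*-identityˡ _)
    ; γ≈ = begin
        γ H             ≈⟨ solve 1 (λ g → g := con (+ 1) :* (:- (:- g))) refl (γ H) ⟩
        1# * - (- γ H)  ≈⟨ *-congˡ (-‿cong ιc≈) ⟨
        1# * - ι c      ∎
    }
    where
    preimage = fixed⇒∈GF[q] (trans (bar-neg (γ H)) (-‿cong (bar-γ H)))
    c = proj₁ preimage
    ιc≈ = proj₂ preimage
    β≉0 : β H ≉ 0#
    β≉0 β≈0 = disc≉0 H (trans (+-cong (*-congʳ β≈0) (-‿cong (*-congʳ α≈0)))
      (solve 2 (λ b g → con (+ 0) :* b :- con (+ 0) :* g := con (+ 0)) refl (bar (β H)) (γ H)))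
  ... | no α≉0 = B¹ s c c≉0 , record
    { scalar = α H ; bar-scalar = bar-α H
    ; α≈ = sym (*-identityʳ _)
    ; β≈ = begin
        β H              ≈⟨ *-identityˡ _ ⟨
        1# * β H         ≈⟨ *-congʳ αi≈1 ⟨
        α H * i * β H    ≈⟨ solve 3 (λ a i b → a :* i :* b := a :* (:- (:- (i :* b)))) refl (α H) i (β H) ⟩
        α H * (- s)      ∎
    ; γ≈ = begin
        γ H
          ≈⟨ solve 1 (λ g → g := con (+ 1) :* con (+ 1) :* g) refl (γ H) ⟩
        1# * 1# * γ H
          ≈⟨ *-congʳ (*-cong αi≈1 αi≈1) ⟨
        α H * i * (α H * i) * γ H
          ≈⟨ solve 5 (λ a i b b̄ g → a :* i :* (a :* i) :* g := a :* ((:- (i :* b)) :* (:- (i :* b̄)) :- (b :* b̄ :- a :* g) :* (i :* i))) refl (α H) i (β H) (bar (β H)) (γ H) ⟩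
        α H * (s * (- (i * bar (β H))) - disc H * (i * i))
          ≈⟨ *-congˡ (+-cong (*-congˡ s̄≈) (-‿cong ιc≈)) ⟨
        α H * (s * bar s - ι c) ∎
    }
    where
    i = α H ⁻¹
    αi≈1 = inverseʳ (α H) α≉0
    bar-i = bar-⁻¹ α≉0 (bar-α H)
    s = - (i * β H)
    s̄≈ : bar s ≈ - (i * bar (β H))
    s̄≈ = trans (bar-neg _) (-‿cong (trans (bar-* _ _) (*-congʳ bar-i)))
    preimage = fixed⇒∈GF[q] {disc H * (i * i)}
      (trans (bar-* _ _) (*-cong (bar-disc H) (trans (bar-* _ _) (*-cong bar-i bar-i))))
    c = proj₁ preimage
    ιc≈ = proj₂ preimage
    c≉0 : c F.≉ F.0#
    c≉0 c≈0 = *-nonZero (disc≉0 H) (*-nonZero (⁻¹-nonZero α≉0) (⁻¹-nonZero α≉0))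
      (trans (sym ιc≈) (trans (⟦⟧-cong c≈0) 0#-homo))

  -- Recovering the form from the points

  double-cancel : ∀ {x y} → x + x ≈ y + y → x ≈ y
  double-cancel {x} {y} 2x≈2y = *-cancelˡ-nonZero (1# + 1#) 2≉0 (trans (twice x) (trans 2x≈2y (sym (twice y))))
    where
    twice : ∀ x → (1# + 1#) * x ≈ x + x
    twice = solve 1 (λ x → (con (+ 1) :+ con (+ 1)) :* x := x :+ x) refl

  -- A circle contains with s + w also s - w; averaging their equations kills
  -- the linear term.
  B¹-⊆ : ∀ {s c c≉0 s′ c′ c′≉0} → ⟦ B¹ s c c≉0 ⟧ ⊆ ⟦ B¹ s′ c′ c′≉0 ⟧ →
    ι c + (s - s′) * bar (s - s′) ≈ ι c′
  B¹-⊆ {s} {c} {c≉0} {s′} {c′} ⊆ with w , ww̄≈c ← norm-surjective (ι-nonZero c≉0) (bar-ι c) =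
    double-cancel (begin
      (ι c + δ * bar δ) + (ι c + δ * bar δ)
        ≈⟨ +-cong (+-congʳ ww̄≈c) (+-congʳ ww̄≈c) ⟨
      (w * bar w + δ * bar δ) + (w * bar w + δ * bar δ)
        ≈⟨ solve 4 (λ w w̄ d d̄ → (w :* w̄ :+ d :* d̄) :+ (w :* w̄ :+ d :* d̄) := (w :+ d) :* (w̄ :+ d̄) :+ (:- w :+ d) :* (:- w̄ :+ d̄)) refl w (bar w) δ (bar δ) ⟩
      (w + δ) * (bar w + bar δ) + (- w + δ) * (- bar w + bar δ)
        ≈⟨ +-cong (point w ww̄≈c) (trans (*-congˡ (+-congʳ (sym (bar-neg w)))) (point (- w) (trans (*-congˡ (bar-neg w)) (trans (solve 2 (λ w w̄ → (:- w) :* (:- w̄) := w :* w̄) refl w (bar w)) ww̄≈c)))) ⟩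
      ι c′ + ι c′ ∎)
    where
    δ = s - s′
    bar-δ : bar δ ≈ bar s - bar s′
    bar-δ = trans (bar-+ _ _) (+-congˡ (bar-neg s′))
    point : ∀ w → w * bar w ≈ ι c → (w + δ) * (bar w + bar δ) ≈ ι c′
    point w ww̄≈c = begin
      (w + δ) * (bar w + bar δ)
        ≈⟨ *-congˡ (+-congˡ bar-δ) ⟩
      (w + (s - s′)) * (bar w + (bar s - bar s′))
        ≈⟨ solve 6 (λ w w̄ s s̄ t t̄ → (w :+ (s :- t)) :* (w̄ :+ (s̄ :- t̄)) := ((w :+ s) :- t) :* ((w̄ :+ s̄) :- t̄)) refl w (bar w) s (bar s) s′ (bar s′) ⟩
      ((w + s) - s′) * ((bar w + bar s) - bar s′)
        ≈⟨ *-congˡ (+-congʳ (bar-+ w s)) ⟨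
      ((w + s) - s′) * (bar (w + s) - bar s′)
        ≈⟨ ⊆ {fin (w + s)} (trans (*-congˡ (+-congʳ (bar-+ w s)))
             (trans (solve 4 (λ w w̄ s s̄ → ((w :+ s) :- s) :* ((w̄ :+ s̄) :- s̄) := w :* w̄) refl w (bar w) s (bar s)) ww̄≈c)) ⟩
      ι c′ ∎

  -- The two inclusions give c + N = c′ and c′ + N = c with the same norm N of s - s′. Hence 2c =
  -- 2c′, then N = 0, and only 0 has norm 0.
  B¹-unique : ∀ {s c c≉0 s′ c′ c′≉0} → ⟦ B¹ s c c≉0 ⟧ ≐ ⟦ B¹ s′ c′ c′≉0 ⟧ → s ≈ s′ × ι c ≈ ι c′
  B¹-unique {s} {c} {c≉0} {s′} {c′} {c′≉0} (⊆ , ⊇) = s≈s′ , ιc≈ιc′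
    where
    N  = (s - s′) * bar (s - s′)
    N′ = (s′ - s) * bar (s′ - s)
    flip : ∀ x y → y - x ≈ - (x - y)
    flip = solve 2 (λ x y → y :- x := :- (x :- y)) refl
    N′≈N : N′ ≈ N
    N′≈N = trans (*-cong (flip s s′) (trans (bar-cong (flip s s′)) (bar-neg _)))
      (solve 2 (λ x y → (:- x) :* (:- y) := x :* y) refl _ _)
    c+N≈c′ : ι c + N ≈ ι c′
    c+N≈c′ = B¹-⊆ {s} {c} {c≉0} {s′} {c′} {c′≉0} (λ {P} → ⊆ {P})
    c′+N≈c : ι c′ + N ≈ ι c
    c′+N≈c = trans (+-congˡ (sym N′≈N)) (B¹-⊆ {s′} {c′} {c′≉0} {s} {c} {c≉0} (λ {P} → ⊇ {P}))
    ιc≈ιc′ : ι c ≈ ι c′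
    ιc≈ιc′ = double-cancel (begin
      ι c + ι c         ≈⟨ +-congˡ c′+N≈c ⟨
      ι c + (ι c′ + N)  ≈⟨ solve 3 (λ c d n → c :+ (d :+ n) := (c :+ n) :+ d) refl (ι c) (ι c′) N ⟩
      (ι c + N) + ι c′  ≈⟨ +-congʳ c+N≈c′ ⟩
      ι c′ + ι c′       ∎)
    s≈s′ : s ≈ s′
    s≈s′ with s ≟ s′
    ... | yes s≈s′ = s≈s′
    ... | no  s≉s′ = contradiction (begin
      N                ≈⟨ solve 2 (λ c n → n := (c :+ n) :- c) refl (ι c) N ⟩
      (ι c + N) - ι c  ≈⟨ +-cong c+N≈c′ (-‿cong ιc≈ιc′) ⟩
      ι c′ - ι c′      ≈⟨ -‿inverseʳ _ ⟩
      0#               ∎) (norm-nonZero (x≉y⇒x-y≉0 s≉s′))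

  -- The line contains the points z = c u / 2 and z + ω u, where u = 1/s̄ and
  -- ω̄ = - ω.
  B²-⊆ : ∀ {s c s≉0 s′ c′ s′≉0} → ⟦ B² s c s≉0 ⟧ ⊆ ⟦ B² s′ c′ s′≉0 ⟧ →
    form (B² s′ c′ s′≉0) ∝ form (B² s c s≉0)
  B²-⊆ {s} {c} {s≉0} {s′} {c′} {s′≉0} ⊆ = record
    -- As `bar u` is the inverse of `s`, this is the ratio of `s′` to `s`. It is fixed by `bar`
    -- because the two chosen points both lie on the second line.
    { scalar = s′ * bar u
    ; bar-scalar = trans (bar-* _ _) (trans (*-congˡ (bar-involutive u)) s̄′u≈s′ū)
    ; α≈ = sym (zeroʳ _)
    ; β≈ = begin
        s′               ≈⟨ *-identityʳ s′ ⟨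
        s′ * 1#          ≈⟨ *-congˡ sū≈1 ⟨
        s′ * (s * bar u) ≈⟨ solve 3 (λ s t v → t :* (s :* v) := t :* v :* s) refl s s′ (bar u) ⟩
        s′ * bar u * s   ∎
    ; γ≈ = begin
        - ι c′
          ≈⟨ -‿cong on-line′ ⟨
        - (bar s′ * (g * u) + s′ * (g * bar u))
          ≈⟨ solve 5 (λ t t̄ g u ū → :- (t̄ :* (g :* u) :+ t :* (g :* ū)) := :- (g :* (t̄ :* u :+ t :* ū))) refl s′ (bar s′) g u (bar u) ⟩
        - (g * (bar s′ * u + s′ * bar u))
          ≈⟨ -‿cong (*-congˡ (+-congʳ s̄′u≈s′ū)) ⟩
        - (g * (s′ * bar u + s′ * bar u))
          ≈⟨ solve 2 (λ g l → :- (g :* (l :+ l)) := l :* (:- (g :+ g))) refl g (s′ * bar u) ⟩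
        s′ * bar u * - (g + g)
          ≈⟨ *-congˡ (-‿cong g+g≈c) ⟩
        s′ * bar u * - ι c ∎
    }
    where
    g u ω : Carrier
    g = (1# + 1#) ⁻¹ * ι c
    u = bar s ⁻¹
    ω = proj₁ ∃-antifixed
    ω≉0 : ω ≉ 0#
    ω≉0 = proj₁ (proj₂ ∃-antifixed)
    ω̄≈-ω : bar ω ≈ - ω
    ω̄≈-ω = proj₂ (proj₂ ∃-antifixed)
    g+g≈c : g + g ≈ ι c
    g+g≈c = begin
      g + g                             ≈⟨ solve 2 (λ h c → h :* c :+ h :* c := (con (+ 1) :+ con (+ 1)) :* h :* c) refl ((1# + 1#) ⁻¹) (ι c) ⟩
      (1# + 1#) * (1# + 1#) ⁻¹ * ι c    ≈⟨ *-congʳ (inverseʳ (1# + 1#) 2≉0) ⟩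
      1# * ι c                          ≈⟨ *-identityˡ (ι c) ⟩
      ι c                               ∎
    bar-g : bar g ≈ g
    bar-g = trans (bar-* ((1# + 1#) ⁻¹) (ι c))
      (*-cong (bar-⁻¹ 2≉0 (trans (bar-+ 1# 1#) (+-cong bar-1 bar-1))) (bar-ι c))
    s̄u≈1 : bar s * u ≈ 1#
    s̄u≈1 = inverseʳ (bar s) (bar-nonZero s≉0)
    sū≈1 : s * bar u ≈ 1#
    sū≈1 = begin
      s * bar u              ≈⟨ *-congʳ (bar-involutive s) ⟨
      bar (bar s) * bar u    ≈⟨ bar-* (bar s) u ⟨
      bar (bar s * u)        ≈⟨ bar-cong s̄u≈1 ⟩
      bar 1#                 ≈⟨ bar-1 ⟩
      1#                     ∎
    line : ∀ {z z̄} → bar z ≈ z̄ → bar s * z + s * z̄ ≈ ι c → bar s′ * z + s′ * z̄ ≈ ι c′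
    line {z} bar-z≈ on = trans (+-congˡ (*-congˡ (sym bar-z≈)))
      (⊆ {fin z} (trans (+-congˡ (*-congˡ bar-z≈)) on))
    bar-gu : bar (g * u) ≈ g * bar u
    bar-gu = trans (bar-* g u) (*-congʳ bar-g)
    on-line : bar s * (g * u) + s * (g * bar u) ≈ ι c
    on-line = begin
      bar s * (g * u) + s * (g * bar u)
        ≈⟨ solve 5 (λ s s̄ g u ū → s̄ :* (g :* u) :+ s :* (g :* ū) := g :* (s̄ :* u) :+ g :* (s :* ū)) refl s (bar s) g u (bar u) ⟩
      g * (bar s * u) + g * (s * bar u)
        ≈⟨ +-cong (*-congˡ s̄u≈1) (*-congˡ sū≈1) ⟩
      g * 1# + g * 1#
        ≈⟨ +-cong (*-identityʳ g) (*-identityʳ g) ⟩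
      g + g
        ≈⟨ g+g≈c ⟩
      ι c ∎
    on-line′ : bar s′ * (g * u) + s′ * (g * bar u) ≈ ι c′
    on-line′ = line bar-gu on-line
    -- Moving the point by `ω * u` adds the last term. It is zero for `s`, so the moved point stays
    -- on the first line; by inclusion it stays on the second, so the term is zero for `s′` too.
    shift : ∀ t → bar t * (g * u + ω * u) + t * (g * bar u + - ω * bar u)
      ≈ (bar t * (g * u) + t * (g * bar u)) + ω * (bar t * u - t * bar u)
    shift t = solve 6 (λ t t̄ g u ū w → t̄ :* (g :* u :+ w :* u) :+ t :* (g :* ū :+ (:- w) :* ū)
      := (t̄ :* (g :* u) :+ t :* (g :* ū)) :+ w :* (t̄ :* u :- t :* ū)) refl t (bar t) g u (bar u) ω
    shifted-on-line : bar s * (g * u + ω * u) + s * (g * bar u + - ω * bar u) ≈ ι c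
    shifted-on-line = begin
      bar s * (g * u + ω * u) + s * (g * bar u + - ω * bar u)                  ≈⟨ shift s ⟩
      (bar s * (g * u) + s * (g * bar u)) + ω * (bar s * u - s * bar u)        ≈⟨ +-cong on-line (*-congˡ (+-cong s̄u≈1 (-‿cong sū≈1))) ⟩
      ι c + ω * (1# - 1#)                                                      ≈⟨ solve 2 (λ c w → c :+ w :* (con (+ 1) :- con (+ 1)) := c) refl (ι c) ω ⟩
      ι c                                                                      ∎
    shifted-on-line′ : bar s′ * (g * u + ω * u) + s′ * (g * bar u + - ω * bar u) ≈ ι c′
    shifted-on-line′ = line
      (trans (bar-+ (g * u) (ω * u)) (+-cong bar-gu (trans (bar-* ω u) (*-congʳ ω̄≈-ω))))
      shifted-on-line
    s̄′u≈s′ū : bar s′ * u ≈ s′ * bar u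
    s̄′u≈s′ū = x∙y⁻¹≈ε⇒x≈y _ _ (xy≈0⇒y≈0 ω ω≉0 (identityʳ-unique (ι c′) _ (begin
      ι c′ + ω * (bar s′ * u - s′ * bar u)                                          ≈⟨ +-congʳ on-line′ ⟨
      (bar s′ * (g * u) + s′ * (g * bar u)) + ω * (bar s′ * u - s′ * bar u)         ≈⟨ shift s′ ⟨
      bar s′ * (g * u + ω * u) + s′ * (g * bar u + - ω * bar u)                     ≈⟨ shifted-on-line′ ⟩
      ι c′                                                                          ∎)))

  -- The point `∞` separates the two types. Within one type the parameters are compared directly, up
  -- to a scalar for lines.
  circle-unique : ∀ C C′ → ⟦ C ⟧ ≐ ⟦ C′ ⟧ → form C′ ∝ form C
  circle-unique (B¹ s c c≉0) (B¹ s′ c′ c′≉0) C≐C′ = record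
    { scalar = 1# ; bar-scalar = bar-1
    ; α≈ = sym (*-identityˡ 1#)
    ; β≈ = trans (-‿cong (sym s≈s′)) (sym (*-identityˡ (- s)))
    ; γ≈ = trans (+-cong (*-cong (sym s≈s′) (bar-cong (sym s≈s′))) (-‿cong (sym c≈c′)))
             (sym (*-identityˡ (s * bar s - ι c)))
    }
    where
    s≈s′×c≈c′ = B¹-unique {s} {c} {c≉0} {s′} {c′} {c′≉0} C≐C′
    s≈s′ = proj₁ s≈s′×c≈c′
    c≈c′ = proj₂ s≈s′×c≈c′
  circle-unique (B¹ s c c≉0) (B² s′ c′ s′≉0) (_ , ⊇) = contradiction (⊇ {∞} _) λ ()
  circle-unique (B² s c s≉0) (B¹ s′ c′ c′≉0) (⊆ , _) = contradiction (⊆ {∞} _) λ ()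
  circle-unique (B² s c s≉0) (B² s′ c′ s′≉0) (⊆ , _) = B²-⊆ {s} {c} {s≉0} {s′} {c′} {s′≉0} (λ {P} → ⊆ {P})

  -- Invariance of the capacitance

  -- `E₁`, `E₂` and `Q` stand for the discriminants and the polar form of the transformed forms,
  -- computed once from the original circles with factor `N` and once from the image circles with
  -- scalars `s` and `t`. Both ratios multiply `E₁ * E₂` to `Q * Q`.
  ratio-unique : ∀ {N s t D₁ D₂ P d₁ d₂ p E₁ E₂ Q κ κ′} → E₁ ≉ 0# → E₂ ≉ 0# →
    E₁ ≈ N * D₁ → E₂ ≈ N * D₂ → Q ≈ N * P →
    E₁ ≈ s * s * d₁ → E₂ ≈ t * t * d₂ → Q ≈ s * t * p →
    κ * (D₁ * D₂) ≈ P * P → κ′ * (d₁ * d₂) ≈ p * p → κ ≈ κ′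
  ratio-unique {N} {s} {t} {D₁} {D₂} {P} {d₁} {d₂} {p} {E₁} {E₂} {Q} {κ} {κ′}
    E₁≉0 E₂≉0 E₁≈ND E₂≈ND Q≈NP E₁≈ssd E₂≈ttd Q≈stp κ-ratio κ′-ratio =
    *-cancelˡ-nonZero (E₁ * E₂) (*-nonZero E₁≉0 E₂≉0) (begin
      E₁ * E₂ * κ                             ≈⟨ *-congʳ (*-cong E₁≈ND E₂≈ND) ⟩
      N * D₁ * (N * D₂) * κ                   ≈⟨ solve 4 (λ n d e k → n :* d :* (n :* e) :* k := n :* n :* (k :* (d :* e))) refl N D₁ D₂ κ ⟩
      N * N * (κ * (D₁ * D₂))                 ≈⟨ *-congˡ κ-ratio ⟩
      N * N * (P * P)                         ≈⟨ square N P ⟩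
      N * P * (N * P)                         ≈⟨ *-cong Q≈NP Q≈NP ⟨
      Q * Q                                   ≈⟨ *-cong Q≈stp Q≈stp ⟩
      s * t * p * (s * t * p)                 ≈⟨ square (s * t) p ⟨
      s * t * (s * t) * (p * p)               ≈⟨ *-congˡ κ′-ratio ⟨
      s * t * (s * t) * (κ′ * (d₁ * d₂))      ≈⟨ solve 5 (λ s t k d e → s :* t :* (s :* t) :* (k :* (d :* e)) := s :* s :* d :* (t :* t :* e) :* k) refl s t κ′ d₁ d₂ ⟩
      s * s * d₁ * (t * t * d₂) * κ′          ≈⟨ *-congʳ (*-cong E₁≈ssd E₂≈ttd) ⟨
      E₁ * E₂ * κ′                            ∎)
    where
    square : ∀ x y → x * x * (y * y) ≈ x * y * (x * y)
    square = solve 2 (λ x y → x :* x :* (y :* y) := x :* y :* (x :* y)) refl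

  image-cong : ∀ τ {S T : Pred Point ℓ₂} → S ≐ T → image τ S ≐ image τ T
  image-cong τ (⊆ , ⊇) = (λ (z , z∈ , τz≈) → z , ⊆ z∈ , τz≈) , (λ (z , z∈ , τz≈) → z , ⊇ z∈ , τz≈)

  module _ (τ : MöbiusTransformation) where

    transform-form-≐ : ∀ B → ⟪ transform τ (form B) ⟫ ≐ image τ ⟦ B ⟧
    transform-form-≐ B = ≐-trans (transform-image τ (form B)) (image-cong τ (form-≐ B))

    ∝⇒describes : ∀ B C → transform τ (form B) ∝ form C → C Describes image τ ⟦ B ⟧
    ∝⇒describes B C H∝C =
      (λ {P} P∈C → proj₁ (transform-form-≐ B) {P} (proj₂ H≐C {P} (proj₂ (form-≐ C) {P} P∈C))) ,
      (λ {P} P∈τB → proj₁ (form-≐ C) {P} (proj₁ H≐C {P} (proj₂ (transform-form-≐ B) {P} P∈τB)))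
      where
      H≐C : ⟪ transform τ (form B) ⟫ ≐ ⟪ form C ⟫
      H≐C = ∝⇒≐ {transform τ (form B)} {form C} H∝C

    image-circle : ∀ B → ∃ λ C → C Describes image τ ⟦ B ⟧
    image-circle B = map₂ (λ {C} → ∝⇒describes B C) (toCircle (transform τ (form B)))

    -- Only the points of `C` are known. They agree with those of the circle `C₀` built by
    -- `toCircle`, whose form is proportional to the transformed one by construction, and
    -- `circle-unique` passes from `C₀` to `C`.
    describes⇒∝ : ∀ B C → C Describes image τ ⟦ B ⟧ → transform τ (form B) ∝ form C
    describes⇒∝ B C C≐τB = compose (toCircle (transform τ (form B)))
      where
      compose : ∃ (λ C₀ → transform τ (form B) ∝ form C₀) → transform τ (form B) ∝ form C
      compose (C₀ , H∝C₀) = ∝-trans H∝C₀ (circle-unique C C₀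
        ((λ {P} P∈C → proj₂ C₀≐τB {P} (proj₁ C≐τB {P} P∈C)) ,
         (λ {P} P∈C₀ → proj₂ C≐τB {P} (proj₁ C₀≐τB {P} P∈C₀))))
        where
        C₀≐τB : C₀ Describes image τ ⟦ B ⟧
        C₀≐τB = ∝⇒describes B C₀ H∝C₀

    cap-invariant : ∀ B B̃ C C̃ → C Describes image τ ⟦ B ⟧ → C̃ Describes image τ ⟦ B̃ ⟧ →
      cap B B̃ ≈ cap C C̃
    cap-invariant B B̃ C C̃ C≐τB C̃≐τB̃ = ratio-unique
      (disc≉0 (transform τ (form B))) (disc≉0 (transform τ (form B̃)))
      (transform-disc τ (form B)) (transform-disc τ (form B̃)) (transform-polar τ (form B) (form B̃))
      (_∝_.disc≈ H∝C) (_∝_.disc≈ H̃∝C̃) (polar-∝ H∝C H̃∝C̃)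
      (cap-polar B B̃) (cap-polar C C̃)
      where
      H∝C : transform τ (form B) ∝ form C
      H∝C = describes⇒∝ B C C≐τB
      H̃∝C̃ : transform τ (form B̃) ∝ form C̃
      H̃∝C̃ = describes⇒∝ B̃ C̃ C̃≐τB̃

open import Data.Nat.Base using (_≤_; _^_)

mainTheorem16 : ∀ {a₁ ℓ₁ a₂ ℓ₂} (p m : ℕ) → Prime p → p ≢ 2 → 1 ≤ m →
    (E : QuadraticExtension (p ^ m) a₁ ℓ₁ a₂ ℓ₂) →
    let open MöbiusPlane E in
    (B B̃ : Circle) (τ : MöbiusTransformation) →
    (∃ λ C → C Describes image τ ⟦ B ⟧) ×
    (∃ λ C̃ → C̃ Describes image τ ⟦ B̃ ⟧) ×
    (∀ C C̃ → C Describes image τ ⟦ B ⟧ → C̃ Describes image τ ⟦ B̃ ⟧ →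
    cap B B̃ K.≈ cap C C̃)
mainTheorem16 p m p-prime p≢2 1≤m E B B̃ τ =
  image-circle τ B , image-circle τ B̃ , cap-invariant τ B B̃
  where open CapacitanceInvariance p-prime p≢2 1≤m E
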